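{- As $n\to\infty$, \[ \tilde r(3,n)=\Omega\left(\frac{n^3}{\log^2 n}\right). \]
   Context: The $(m,n)$-online Ramsey game is played by two players, Builder and Painter, on an infinite set of initially isolated vertices. Each turn, Builder places an edge between two nonadjacent vertices and Painter immediately paints it red or blue. The online Ramsey number $\tilde r(m,n)$ is the smallest number of turns within which Builder can guarantee the existence of either a red $K_m$ or a blue $K_n$, whatever Painter does. Logarithms are natural; the implicit constant in $\Omega$ is a positive absolute constant. -}

module Defs where

open import Algebra.Definitions.RawSemiring using () renaming (_^_ to pow)
open import Data.Fin.Base using (Fin)
import Data.Integer.Base as ℤ
open import Data.List.Base using (List; []; _∷_)
open import Data.List.Membership.Propositional using (_∈_)
open import Data.Nat.Base as ℕ using (ℕ; zero; suc; _!)
open import Data.Nat.Properties using (_!≢0)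
open import Data.Product.Base using (∃-syntax; _×_; _,_)
open import Data.Rational.Base using (ℚ; 0ℚ; 1ℚ; _+_; _*_; _<_; _/_; +-*-rawSemiring)
open import Data.Sum.Base using (_⊎_)
open import Function.Definitions using (Injective)
open import Relation.Binary.PropositionalEquality.Core using (_≡_; _≢_)
open import Relation.Nullary.Negation.Core using (¬_)

data Colour : Set where
  red blue : Colour

Vertex : Set
Vertex = ℕ

-- The edges painted so far; each unordered edge {u , v} is recorded as
-- (u , v , c) in the orientation in which Builder named it.
Board : Set
Board = List (Vertex × Vertex × Colour)

Edge : Board → Colour → Vertex → Vertex → Set
Edge B c u v = (u , v , c) ∈ B ⊎ (v , u , c) ∈ B

Adjacent : Board → Vertex → Vertex → Set
Adjacent B u v = ∃[ c ] Edge B c u v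

HasClique : Board → Colour → ℕ → Set
HasClique B c k = ∃[ f ] Injective {A = Fin k} {B = Vertex} _≡_ _≡_ f
                       × (∀ i j → i ≢ j → Edge B c (f i) (f j))

Goal : ℕ → ℕ → Board → Set
Goal m n B = HasClique B red m ⊎ HasClique B blue n

-- From board B, Builder can guarantee the goal within t further turns:
-- Builder's move is existential, Painter's reply universal.
BuilderWins : (m n t : ℕ) → Board → Set
BuilderWins m n zero    B = Goal m n B
BuilderWins m n (suc t) B =
  Goal m n B ⊎
  ∃[ u ] ∃[ v ] u ≢ v × ¬ Adjacent B u v
    × (∀ c → BuilderWins m n t ((u , v , c) ∷ B))

IsOnlineRamseyNumber : (m n r : ℕ) → Set
IsOnlineRamseyNumber m n r =
  BuilderWins m n r [] × (∀ t → BuilderWins m n t [] → r ℕ.≤ t)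

infixr 8 _^_

_^_ : ℚ → ℕ → ℚ
_^_ = pow +-*-rawSemiring

fromℕ : ℕ → ℚ
fromℕ n = ℤ.+ n / 1

expSum : ℚ → ℕ → ℚ
expSum u zero    = 1ℚ
expSum u (suc k) =
  expSum u k + u ^ suc k * (_/_ (ℤ.+ 1) (suc k !) {{suc k !≢0}})

-- Upper Dedekind cut of the real number log n: for n ≥ 1 this says
-- log n < u, i.e. n < exp u.  Since log n ≥ 0, only u > 0 can qualify, and
-- for such u the sums Σ_{i ≤ k} uⁱ / i! increase strictly to exp u, so
-- n < exp u iff one of them exceeds n.
-- For n ≥ 2, r · log² n is the infimum of r · u² over such u; hence
-- a real inequality x ≤ r · log² n amounts to x ≤ r · u² for all of them.
log_<ℚ_ : ℕ → ℚ → Set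
log n <ℚ u = 0ℚ < u × ∃[ k ] fromℕ n < expSum u k

module Submission where

-- Call a vertex active once its degree reaches τ ≈ n/8; after r turns at most
-- M = 2r/τ vertices are.  Painter colours an edge with an inactive end blue.  An
-- edge between active vertices is blue if red would close a red triangle, and is
-- otherwise red with probability 1/(k + 1), where k ≈ n/log n.
--
-- A blue Kₙ has at most nτ edges drawn while an end was inactive.  For a given
-- n-set without red edges, n²/32 coin flips all giving blue has probability
-- n^(-Ω(n)), which beats the M^n choices of the set.  The remaining edges of the
-- clique close a path of two red edges; there are at most Σ d(w)² of them, where
-- d(w) counts the red edges from w into the set.  As red degrees stay below k,
-- this is at most 4K²M + 2k Σ max(d(w) - K, 0), and for K = O(log n) the
-- exponential moment of the last sum is bounded.  When r is a small multiple of
-- n³/log² n these bounds leave some pair of the n-set uncovered.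
--
-- The randomness is removed by conditional expectations: the potential Φ bounds
-- the probability that one of these estimates fails, no flip increases it on
-- average, and so Painter can choose each outcome without increasing it.


-- All probabilities are scaled by powers of `k`, so the potentials are natural numbers and "no
-- increase on average" is the single inequality `Fair`. Builder's vertices are unknown in advance,
-- hence the potentials live on indices below `M`, and a vertex takes the next free index when it
-- becomes active; this also fixes the family of n-sets for the union bound beforehand.
--
-- A product is shown to be fair only when the flipped coin meets one of its factors. That is why
-- d(w) is controlled only for w outside the set: rows of different outside vertices then share no
-- coin. Nothing is lost, since the midpoint of a red path between two vertices of a blue clique
-- lies outside the clique.
--
-- The sum of d(w)² has too heavy a tail for an exponential moment. Cutting at `K`, with red degrees
-- below `k` known separately, leaves a linear excess, and its moment can compete with M^n.
--
-- What is proved is that Builder does not win, a negation; so Painter's case distinctions may use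
-- excluded middle under a double negation.

module Game where

  open import Defs using (Colour; red; blue; Vertex; Board; Edge; Adjacent; HasClique; Goal; BuilderWins)
  open import Data.Bool.Base using (Bool; true; false; if_then_else_; _∧_)
  open import Data.Empty using (⊥)
  open import Data.Fin.Base using (zero; suc; fromℕ<)
  open import Data.Fin.Properties using (fromℕ<-injective)
  open import Data.List.Base using (List; []; _∷_; length; applyDownFrom)
  open import Data.List.Properties using (length-applyDownFrom)
  open import Data.List.Membership.Propositional.Properties using (∈-applyDownFrom⁺; ∈-applyDownFrom⁻)
  open import Data.List.Relation.Unary.All using (All; []; _∷_)
  import Data.List.Relation.Unary.All.Properties as All
  open import Data.List.Relation.Unary.Any using (here; there)
  open import Data.Nat.Base using (ℕ; zero; suc; _+_; _*_; _^_; _∸_; _≤_; _<_; z≤n; s≤s; NonZero; >-nonZero; _/_)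
  open import Data.Nat.DivMod using (m≡m%n+[m/n]*n; m%n<n; m/n*n≤m; /-monoˡ-≤)
  open import Data.Nat.Properties
  open import Data.List.Membership.DecPropositional _≟_ using (_∈?_)
  open import Data.Nat.Tactic.RingSolver using (solve-∀)
  open import Data.Product.Base using (_×_; _,_; proj₁; proj₂; ∃-syntax)
  open import Data.Sum.Base using (_⊎_; inj₁; inj₂; swap; [_,_]′) renaming (map to map⊎)
  open import Function.Base using (_∘_; case_of_)
  open import Relation.Binary.PropositionalEquality
  open import Relation.Nullary using (Dec; yes; no; ¬_; does; contradiction)
  open import Relation.Nullary.Decidable using (dec-true; dec-false; from-yes; ¬¬-excluded-middle)

  -- Finite sums and products

  ⟦_⟧ : ∀ {P : Set} → Dec P → ℕ
  ⟦ d ⟧ = if does d then 1 else 0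

  ⟦⟧-yes : ∀ {P : Set} (d : Dec P) → P → ⟦ d ⟧ ≡ 1
  ⟦⟧-yes (yes _) _ = refl
  ⟦⟧-yes (no ¬p) p = contradiction p ¬p

  ⟦⟧-no : ∀ {P : Set} (d : Dec P) → ¬ P → ⟦ d ⟧ ≡ 0
  ⟦⟧-no (yes p) ¬p = contradiction p ¬p
  ⟦⟧-no (no _) _ = refl

  ⟦⟧≤1 : ∀ {P : Set} (d : Dec P) → ⟦ d ⟧ ≤ 1
  ⟦⟧≤1 (yes _) = ≤-refl
  ⟦⟧≤1 (no _) = z≤n

  ⟦⟧-≤ : ∀ {P : Set} (d : Dec P) {c} → (P → 1 ≤ c) → ⟦ d ⟧ ≤ c
  ⟦⟧-≤ (yes p) h = h p
  ⟦⟧-≤ (no _)  _ = z≤n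

  ∑ : ℕ → (ℕ → ℕ) → ℕ
  ∑ zero    f = 0
  ∑ (suc m) f = f m + ∑ m f

  ∏ : ℕ → (ℕ → ℕ) → ℕ
  ∏ zero    f = 1
  ∏ (suc m) f = f m * ∏ m f

  ∑-mono : ∀ m {f g} → (∀ i → i < m → f i ≤ g i) → ∑ m f ≤ ∑ m g
  ∑-mono zero    h = z≤n
  ∑-mono (suc m) h = +-mono-≤ (h m ≤-refl) (∑-mono m λ i i<m → h i (m<n⇒m<1+n i<m))

  ∑-cong : ∀ m {f g} → (∀ i → f i ≡ g i) → ∑ m f ≡ ∑ m g
  ∑-cong zero    h = refl
  ∑-cong (suc m) h = cong₂ _+_ (h m) (∑-cong m h)

  ∑-const : ∀ m c → ∑ m (λ _ → c) ≡ m * c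
  ∑-const zero    c = refl
  ∑-const (suc m) c = cong (c +_) (∑-const m c)

  ∑-≤-const : ∀ m {f} c → (∀ i → i < m → f i ≤ c) → ∑ m f ≤ m * c
  ∑-≤-const m c h = subst (_ ≤_) (∑-const m c) (∑-mono m h)

  ∑-distrib-+ : ∀ m f g → ∑ m (λ i → f i + g i) ≡ ∑ m f + ∑ m g
  ∑-distrib-+ zero    f g = refl
  ∑-distrib-+ (suc m) f g rewrite ∑-distrib-+ m f g = lemma (f m) (g m) (∑ m f) (∑ m g)
    where
    lemma : ∀ a b c d → a + b + (c + d) ≡ a + c + (b + d)
    lemma = solve-∀

  ∑-distribˡ-* : ∀ m c f → ∑ m (λ i → c * f i) ≡ c * ∑ m f
  ∑-distribˡ-* zero    c f = sym (*-zeroʳ c)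
  ∑-distribˡ-* (suc m) c f rewrite ∑-distribˡ-* m c f = sym (*-distribˡ-+ c (f m) (∑ m f))

  ∑-distribʳ-* : ∀ m c f → ∑ m (λ i → f i * c) ≡ ∑ m f * c
  ∑-distribʳ-* zero    c f = refl
  ∑-distribʳ-* (suc m) c f rewrite ∑-distribʳ-* m c f = sym (*-distribʳ-+ c (f m) (∑ m f))

  ∑-swap : ∀ m n (f : ℕ → ℕ → ℕ) → ∑ m (λ i → ∑ n (f i)) ≡ ∑ n (λ j → ∑ m (λ i → f i j))
  ∑-swap zero    n f = sym (trans (∑-const n 0) (*-zeroʳ n))
  ∑-swap (suc m) n f rewrite ∑-swap m n f = sym (∑-distrib-+ n (f m) (λ j → ∑ m (λ i → f i j)))

  term≤∑ : ∀ {m i} f → i < m → f i ≤ ∑ m f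
  term≤∑ {suc m} {i} f i<1+m with i ≟ m
  ... | yes refl = m≤m+n (f m) _
  ... | no i≢m = ≤-trans (term≤∑ f (≤∧≢⇒< (≤-pred i<1+m) i≢m)) (m≤n+m _ (f m))

  InjectiveBelow : ℕ → (ℕ → ℕ) → Set
  InjectiveBelow m h = ∀ {i j} → i < m → j < m → h i ≡ h j → i ≡ j

  ∑-fibre≤1 : ∀ m {h} → InjectiveBelow m h → ∀ v → ∑ m (λ j → ⟦ h j ≟ v ⟧) ≤ 1
  ∑-fibre≤1 zero    inj v = z≤n
  ∑-fibre≤1 (suc m) {h} inj v with h m ≟ v
  ... | yes refl rewrite ⟦⟧-yes (h m ≟ h m) refl = s≤s (≤-trans (∑-≤-const m 0 zeros) (≤-reflexive (*-zeroʳ m)))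
    where
    zeros : ∀ i → i < m → ⟦ h i ≟ h m ⟧ ≤ 0
    zeros i i<m = ≤-reflexive (⟦⟧-no (h i ≟ h m) λ e → <⇒≢ i<m (inj (m<n⇒m<1+n i<m) ≤-refl e))
  ... | no hm≢v rewrite ⟦⟧-no (h m ≟ v) hm≢v =
    ∑-fibre≤1 m (λ i<m j<m → inj (m<n⇒m<1+n i<m) (m<n⇒m<1+n j<m)) v

  -- Passes from the positions in a clique, where the board is inspected, to the indices below `M`,
  -- where the potentials are summed: `ι` hits each index at most once. In the applications `w` is
  -- the indicator of the image of `ι`.
  ∑-reindex : ∀ n M {ι w : ℕ → ℕ} (f : ℕ → ℕ) → InjectiveBelow n ι → (∀ p → p < n → ι p < M) →
              (∀ p → p < n → 1 ≤ w (ι p)) → ∑ n (λ p → f (ι p)) ≤ ∑ M (λ i → w i * f i)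
  ∑-reindex n M {ι} {w} f inj bound w≥1 = begin
    ∑ n (λ p → f (ι p))                                   ≤⟨ ∑-mono n pointwise ⟩
    ∑ n (λ p → ∑ M (λ i → ⟦ ι p ≟ i ⟧ * (w i * f i)))     ≡⟨ ∑-swap n M _ ⟩
    ∑ M (λ i → ∑ n (λ p → ⟦ ι p ≟ i ⟧ * (w i * f i)))     ≡⟨ ∑-cong M (λ i → ∑-distribʳ-* n (w i * f i) _) ⟩
    ∑ M (λ i → ∑ n (λ p → ⟦ ι p ≟ i ⟧) * (w i * f i))
      ≤⟨ ∑-mono M (λ i _ → *-monoˡ-≤ (w i * f i) (∑-fibre≤1 n inj i)) ⟩
    ∑ M (λ i → 1 * (w i * f i))                           ≡⟨ ∑-cong M (λ i → *-identityˡ _) ⟩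
    ∑ M (λ i → w i * f i)                                 ∎
    where
    open ≤-Reasoning
    pointwise : ∀ p → p < n → f (ι p) ≤ ∑ M (λ i → ⟦ ι p ≟ i ⟧ * (w i * f i))
    pointwise p p<n = begin
      f (ι p)                                  ≡⟨ *-identityˡ _ ⟨
      1 * f (ι p)                              ≤⟨ *-monoˡ-≤ (f (ι p)) (w≥1 p p<n) ⟩
      w (ι p) * f (ι p)                        ≡⟨ *-identityˡ _ ⟨
      1 * (w (ι p) * f (ι p))                  ≡⟨ cong (_* (w (ι p) * f (ι p))) (⟦⟧-yes (ι p ≟ ι p) refl) ⟨
      ⟦ ι p ≟ ι p ⟧ * (w (ι p) * f (ι p))      ≤⟨ term≤∑ (λ i → ⟦ ι p ≟ i ⟧ * (w i * f i)) (bound p p<n) ⟩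
      ∑ M (λ i → ⟦ ι p ≟ i ⟧ * (w i * f i))    ∎

  ∏-mono : ∀ m {f g} → (∀ i → i < m → f i ≤ g i) → ∏ m f ≤ ∏ m g
  ∏-mono zero    h = ≤-refl
  ∏-mono (suc m) h = *-mono-≤ (h m ≤-refl) (∏-mono m λ i i<m → h i (m<n⇒m<1+n i<m))

  ∏-cong : ∀ m {f g} → (∀ i → f i ≡ g i) → ∏ m f ≡ ∏ m g
  ∏-cong zero    h = refl
  ∏-cong (suc m) h = cong₂ _*_ (h m) (∏-cong m h)

  ∏-const : ∀ m c → ∏ m (λ _ → c) ≡ c ^ m
  ∏-const zero    c = refl
  ∏-const (suc m) c = cong (c *_) (∏-const m c)

  ∏-≤-const : ∀ m {f} c → (∀ i → i < m → f i ≤ c) → ∏ m f ≤ c ^ m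
  ∏-≤-const m c h = subst (_ ≤_) (∏-const m c) (∏-mono m h)

  ∏-distrib-* : ∀ m f g → ∏ m (λ i → f i * g i) ≡ ∏ m f * ∏ m g
  ∏-distrib-* zero    f g = refl
  ∏-distrib-* (suc m) f g rewrite ∏-distrib-* m f g = lemma (f m) (g m) (∏ m f) (∏ m g)
    where
    lemma : ∀ a b c d → a * b * (c * d) ≡ a * c * (b * d)
    lemma = solve-∀

  ∏-^-∑ : ∀ m b e → ∏ m (λ i → b ^ e i) ≡ b ^ ∑ m e
  ∏-^-∑ zero    b e = refl
  ∏-^-∑ (suc m) b e rewrite ∏-^-∑ m b e = sym (^-distribˡ-+-* b (e m) (∑ m e))

  -- Potentials that no coin flip increases on average

  data Coin : Set where
    unflipped heads tails : Coin

  -- A flip for the edge between the active vertices i and j is recorded either at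
  -- (i , j) or at (j , i), never at both.
  Flips : Set
  Flips = ℕ → ℕ → Coin

  infixl 9 _[_,_↦_]

  _[_,_↦_] : Flips → ℕ → ℕ → Coin → Flips
  (st [ i , j ↦ c ]) a b = if does (a ≟ i) ∧ does (b ≟ j) then c else st a b

  update-hit : ∀ st i j {c} → (st [ i , j ↦ c ]) i j ≡ c
  update-hit st i j rewrite dec-true (i ≟ i) refl | dec-true (j ≟ j) refl = refl

  update-missˡ : ∀ st {i j c a b} → a ≢ i → (st [ i , j ↦ c ]) a b ≡ st a b
  update-missˡ st {i} {a = a} a≢i rewrite dec-false (a ≟ i) a≢i = refl

  update-missʳ : ∀ st {i j c a b} → b ≢ j → (st [ i , j ↦ c ]) a b ≡ st a b
  update-missʳ st {i} {j} {a = a} {b} b≢j rewrite dec-false (b ≟ j) b≢j with does (a ≟ i)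
  ... | true  = refl
  ... | false = refl

  update-cases : ∀ st i j {c} a b → (a ≡ i → b ≡ j → c ≡ st a b) → (st [ i , j ↦ c ]) a b ≡ st a b
  update-cases st i j a b h with a ≟ i | b ≟ j
  ... | no a≢i   | _        = update-missˡ st a≢i
  ... | yes refl | no b≢j   = update-missʳ st b≢j
  ... | yes refl | yes refl = trans (update-hit st a b) (h refl refl)

  module _ (k : ℕ) where

    -- A coin shows heads with probability 1/(k + 1), so this says that flipping
    -- it does not increase g on average.
    record Fair (g : Coin → ℕ) : Set where
      constructor mkFair
      field average : g heads + k * g tails ≤ suc k * g unflipped

    Constant : (Coin → ℕ) → Set
    Constant g = ∀ c → g c ≡ g unflipped

    fair-constant : ∀ {g} → Constant g → Fair g
    fair-constant const = mkFair (≤-reflexive (cong₂ _+_ (const heads) (cong (k *_) (const tails))))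

    fair-const : ∀ a → Fair (λ _ → a)
    fair-const a = mkFair ≤-refl

    fair-cong : ∀ {g h} → (∀ c → g c ≡ h c) → Fair g → Fair h
    fair-cong g≗h (mkFair fg) =
      mkFair (subst₂ _≤_ (cong₂ _+_ (g≗h heads) (cong (k *_) (g≗h tails))) (cong (suc k *_) (g≗h unflipped)) fg)

    fair-+ : ∀ {g h} → Fair g → Fair h → Fair (λ c → g c + h c)
    fair-+ {g} {h} (mkFair fg) (mkFair fh) = mkFair (subst₂ _≤_ (lhs (g heads) (h heads) k (g tails) (h tails))
      (sym (*-distribˡ-+ (suc k) (g unflipped) (h unflipped))) (+-mono-≤ fg fh))
      where
      lhs : ∀ a b k c d → a + k * c + (b + k * d) ≡ a + b + k * (c + d)
      lhs = solve-∀

    fair-* : ∀ {g h} → Fair g → Constant h → Fair (λ c → g c * h c)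
    fair-* {g} {h} (mkFair fg) const = mkFair (subst₂ _≤_
      (trans (lhs (g heads) k (g tails) (h unflipped))
        (cong₂ (λ x y → g heads * x + k * (g tails * y)) (sym (const heads)) (sym (const tails))))
      (*-assoc (suc k) (g unflipped) (h unflipped))
      (*-monoˡ-≤ (h unflipped) fg))
      where
      lhs : ∀ a k b x → (a + k * b) * x ≡ a * x + k * (b * x)
      lhs = solve-∀

    fair-*ˡ : ∀ a {g} → Fair g → Fair (λ c → a * g c)
    fair-*ˡ a {g} fg = fair-cong (λ c → *-comm (g c) a) (fair-* {g} {λ _ → a} fg (λ _ → refl))

    fair-∑ : ∀ m {g : Coin → ℕ → ℕ} → (∀ i → Fair (λ c → g c i)) → Fair (λ c → ∑ m (g c))
    fair-∑ zero    fg = fair-const 0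
    fair-∑ (suc m) {g} fg = fair-+ {λ c → g c m} {λ c → ∑ m (g c)} (fg m) (fair-∑ m fg)

    constant-∏ : ∀ m {g : Coin → ℕ → ℕ} → (∀ i → i < m → Constant (λ c → g c i)) → Constant (λ c → ∏ m (g c))
    constant-∏ zero    const c = refl
    constant-∏ (suc m) const c = cong₂ _*_ (const m ≤-refl c) (constant-∏ m (λ i i<m → const i (m<n⇒m<1+n i<m)) c)

    -- This stands in for independence of the coins: only the factor `i₀` sees the flip, and the
    -- others leave the average as constants.
    fair-∏ : ∀ m {g : Coin → ℕ → ℕ} i₀ → (∀ i → i ≢ i₀ → Constant (λ c → g c i)) →
             Fair (λ c → g c i₀) → Fair (λ c → ∏ m (g c))
    fair-∏ zero    i₀ const fg = fair-const 1
    fair-∏ (suc m) {g} i₀ const fg with m ≟ i₀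
    ... | yes refl = fair-* {λ c → g c m} {λ c → ∏ m (g c)} fg (constant-∏ m λ i i<m → const i (<⇒≢ i<m))
    ... | no m≢i₀ = fair-cong
      (λ c → trans (*-comm (∏ m (g c)) (g unflipped m)) (cong (_* ∏ m (g c)) (sym (const m m≢i₀ c))))
                        (fair-* {λ c → ∏ m (g c)} {λ _ → g unflipped m} (fair-∏ m i₀ const fg) (λ _ → refl))

    -- k · 2^[heads] after the flip; k + 1 is at least the mean of this before it.
    degreeWeight : Coin → ℕ
    degreeWeight unflipped = suc k
    degreeWeight heads     = 2 * k
    degreeWeight tails     = k

    degreeWeight-fair : Fair degreeWeight
    degreeWeight-fair = mkFair (subst (2 * k + k * k ≤_) (lemma k) (n≤1+n _))
      where
      lemma : ∀ k → 1 + (2 * k + k * k) ≡ (1 + k) * (1 + k)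
      lemma = solve-∀

    -- k · (1 + 1/k)^[tails], but 0 after heads, so that the mean is k.
    tailsWeight : Coin → ℕ
    tailsWeight unflipped = k
    tailsWeight heads     = 0
    tailsWeight tails     = suc k

    tailsWeight-fair : Fair tailsWeight
    tailsWeight-fair = mkFair (≤-reflexive (*-comm k (suc k)))

    -- A flip may be recorded in either orientation, so both cells enter. The cell that stays empty
    -- keeps the weight k + 1 instead of k, which wastes only a factor 1 + 1/k per pair.
    pairWeight : Flips → ℕ → ℕ → ℕ
    pairWeight st w s = degreeWeight (st w s) * degreeWeight (st s w)

    module _ (M : ℕ) where

      row : (ℕ → Bool) → Flips → ℕ → ℕ
      row χ st w = ∏ M λ s → if χ s then pairWeight st w s else k * k

      degreePotential : Flips → ℕ → ℕ
      degreePotential = row (λ _ → true)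

      -- With Q = 2^K k^(2M) the factor of w is, up to scaling, 1 + 2^(d(w) - K),
      -- which is at least 2^max(d(w) - K, 0).
      excessPotential : ℕ → (ℕ → Bool) → Flips → ℕ
      excessPotential Q χ st = ∏ M λ w → if χ w then Q else Q + row χ st w

      -- A heads inside χ makes the product vanish, so sets with a red edge drop out of the union
      -- bound.
      independentPotential : (ℕ → Bool) → Flips → ℕ
      independentPotential χ st = ∏ M λ i → ∏ M λ j → if χ i ∧ χ j then tailsWeight (st i j) else k

      module _ (st : Flips) {i j : ℕ} (i≢j : i ≢ j) where

        private
          flip : Coin → Flips
          flip c = st [ i , j ↦ c ]

        pairWeight-constant : ∀ {w s} → (w ≡ i → s ≢ j) → (w ≡ j → s ≢ i) → Constant (λ c → pairWeight (flip c) w s)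
        pairWeight-constant {w} {s} h₁ h₂ c = cong₂ (λ a b → degreeWeight a * degreeWeight b)
          (trans (update-cases st i j w s λ e f → contradiction f (h₁ e))
                 (sym (update-cases st i j w s λ e f → contradiction f (h₁ e))))
          (trans (update-cases st i j s w λ e f → contradiction e (h₂ f))
                 (sym (update-cases st i j s w λ e f → contradiction e (h₂ f))))

        pairWeight-fairᵢ : Fair (λ c → pairWeight (flip c) i j)
        pairWeight-fairᵢ = fair-*
          (fair-cong (λ c → cong degreeWeight (sym (update-hit st i j))) degreeWeight-fair)
          (λ c → cong degreeWeight (trans (update-missˡ st (i≢j ∘ sym)) (sym (update-missˡ st (i≢j ∘ sym)))))

        pairWeight-fairⱼ : Fair (λ c → pairWeight (flip c) j i)
        pairWeight-fairⱼ = fair-cong (λ c → *-comm (degreeWeight (flip c i j)) (degreeWeight (flip c j i))) pairWeight-fairᵢ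

        -- The coin (i , j) is visible only in row `i` at column `j` and in row `j` at column `i`;
        -- the hypotheses say that χ hides these columns.
        row-constant : ∀ {χ w} → (w ≡ i → χ j ≡ false) → (w ≡ j → χ i ≡ false) → Constant (λ c → row χ (flip c) w)
        row-constant {χ} {w} h₁ h₂ = constant-∏ M {λ c s → if χ s then pairWeight (flip c) w s else k * k} entry
          where
          entry : ∀ s → s < M → Constant (λ c → if χ s then pairWeight (flip c) w s else k * k)
          entry s _ c with χ s in χs
          ... | false = refl
          ... | true  = pairWeight-constant {w} {s} (λ { e refl → contradiction (trans (sym χs) (h₁ e)) λ () })
                                                    (λ { e refl → contradiction (trans (sym χs) (h₂ e)) λ () }) c

        row-fair : ∀ χ w → Fair (λ c → row χ (flip c) w)
        row-fair χ w with w ≟ i | w ≟ j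
        ... | no w≢i | no w≢j = fair-constant (row-constant (λ e → contradiction e w≢i) (λ e → contradiction e w≢j))
        ... | yes refl | _ = fair-∏ M j const fair
          where
          const : ∀ s → s ≢ j → Constant (λ c → if χ s then pairWeight (flip c) i s else k * k)
          const s s≢j c with χ s
          ... | false = refl
          ... | true  = pairWeight-constant (λ _ → s≢j) (λ e → contradiction e i≢j) c
          fair : Fair (λ c → if χ j then pairWeight (flip c) i j else k * k)
          fair with χ j
          ... | false = fair-const (k * k)
          ... | true  = pairWeight-fairᵢ
        ... | no _ | yes refl = fair-∏ M i const fair
          where
          const : ∀ s → s ≢ i → Constant (λ c → if χ s then pairWeight (flip c) j s else k * k)
          const s s≢i c with χ s
          ... | false = refl
          ... | true  = pairWeight-constant (λ e → contradiction (sym e) i≢j) (λ _ → s≢i) c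
          fair : Fair (λ c → if χ i then pairWeight (flip c) j i else k * k)
          fair with χ i
          ... | false = fair-const (k * k)
          ... | true  = pairWeight-fairⱼ

        -- At most one factor is affected: if i ∈ χ then factor i is trivial,
        -- and otherwise row j ignores column i.
        excessPotential-fair : ∀ Q χ → Fair (λ c → excessPotential Q χ (flip c))
        excessPotential-fair Q χ with χ i in χi
        ... | true = fair-∏ M j const (factor-fair j)
          where
          factor-fair : ∀ w → Fair (λ c → if χ w then Q else Q + row χ (flip c) w)
          factor-fair w with χ w
          ... | true  = fair-const Q
          ... | false = fair-+ {λ _ → Q} (fair-const Q) (row-fair χ w)
          const : ∀ w → w ≢ j → Constant (λ c → if χ w then Q else Q + row χ (flip c) w)
          const w w≢j c with χ w in χw
          ... | true  = refl
          ... | false = cong (Q +_) (row-constant (λ { refl → contradiction (trans (sym χi) χw) λ () })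
                                                  (λ e → contradiction e w≢j) c)
        ... | false = fair-∏ M i const (factor-fair i)
          where
          factor-fair : ∀ w → Fair (λ c → if χ w then Q else Q + row χ (flip c) w)
          factor-fair w with χ w
          ... | true  = fair-const Q
          ... | false = fair-+ {λ _ → Q} (fair-const Q) (row-fair χ w)
          const : ∀ w → w ≢ i → Constant (λ c → if χ w then Q else Q + row χ (flip c) w)
          const w w≢i c with χ w
          ... | true  = refl
          ... | false = cong (Q +_) (row-constant (λ e → contradiction e w≢i) (λ _ → χi) c)

        -- Each orientation has a cell of its own, so a flip changes one entry of one inner product.
        independentPotential-fair : ∀ χ → Fair (λ c → independentPotential χ (flip c))
        independentPotential-fair χ = fair-∏ M i
          (λ a a≢i → constant-∏ M λ b _ → entry-constant a b λ e → contradiction e a≢i)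
          (fair-∏ M j (λ b b≢j → entry-constant i b λ _ → b≢j) entry-fair)
          where
          entry : Flips → ℕ → ℕ → ℕ
          entry st′ a b = if χ a ∧ χ b then tailsWeight (st′ a b) else k
          entry-constant : ∀ a b → (a ≡ i → b ≢ j) → Constant (λ c → entry (flip c) a b)
          entry-constant a b h c = cong (λ x → if χ a ∧ χ b then tailsWeight x else k)
            (trans (update-cases st i j a b λ e f → contradiction f (h e))
                   (sym (update-cases st i j a b λ e f → contradiction f (h e))))
          entry-fair : Fair (λ c → entry (flip c) i j)
          entry-fair with χ i ∧ χ j
          ... | false = fair-const k
          ... | true  = fair-cong (λ c → cong tailsWeight (sym (update-hit st i j))) tailsWeight-fair

  -- Lists stand for the n-sets of indices. Repeated entries do no harm, as only membership matters,
  -- and the number of lists is exactly the M^n of the union bound.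
  ∑ᴸ : ℕ → ℕ → (List ℕ → ℕ) → ℕ
  ∑ᴸ zero    M F = F []
  ∑ᴸ (suc n) M F = ∑ M λ i → ∑ᴸ n M λ L → F (i ∷ L)

  -- Initial and final values of the potentials

  ∑ᴸ-≤ : ∀ n M {F c} → (∀ L → length L ≡ n → F L ≤ c) → ∑ᴸ n M F ≤ M ^ n * c
  ∑ᴸ-≤ zero    M {c = c} h = ≤-trans (h [] refl) (≤-reflexive (sym (*-identityˡ c)))
  ∑ᴸ-≤ (suc n) M {c = c} h = ≤-trans
    (∑-≤-const M (M ^ n * c) λ i _ → ∑ᴸ-≤ n M λ L len → h (i ∷ L) (cong suc len))
    (≤-reflexive (sym (*-assoc M (M ^ n) c)))

  ∑ᴸ-cong : ∀ n M {F G} → (∀ L → F L ≡ G L) → ∑ᴸ n M F ≡ ∑ᴸ n M G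
  ∑ᴸ-cong zero    M h = h []
  ∑ᴸ-cong (suc n) M h = ∑-cong M λ i → ∑ᴸ-cong n M λ L → h (i ∷ L)

  term≤∑ᴸ : ∀ {M} F {L} → All (_< M) L → F L ≤ ∑ᴸ (length L) M F
  term≤∑ᴸ F [] = ≤-refl
  term≤∑ᴸ {M} F {i ∷ L} (i<M ∷ L<M) =
    ≤-trans (term≤∑ᴸ (λ L′ → F (i ∷ L′)) L<M) (term≤∑ (λ i → ∑ᴸ (length L) M λ L′ → F (i ∷ L′)) i<M)

  member : List ℕ → ℕ → Bool
  member L i = does (i ∈? L)

  ∑-member≤length : ∀ M L → ∑ M (λ i → ⟦ i ∈? L ⟧) ≤ length L
  ∑-member≤length M [] = ≤-trans (∑-≤-const M 0 λ _ _ → ≤-refl) (≤-reflexive (*-zeroʳ M))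
  ∑-member≤length M (x ∷ L) = begin
    ∑ M (λ i → ⟦ i ∈? x ∷ L ⟧)                      ≤⟨ ∑-mono M (λ i _ → pointwise i) ⟩
    ∑ M (λ i → ⟦ i ≟ x ⟧ + ⟦ i ∈? L ⟧)              ≡⟨ ∑-distrib-+ M (λ i → ⟦ i ≟ x ⟧) (λ i → ⟦ i ∈? L ⟧) ⟩
    ∑ M (λ i → ⟦ i ≟ x ⟧) + ∑ M (λ i → ⟦ i ∈? L ⟧)  ≤⟨ +-mono-≤ (∑-fibre≤1 M (λ _ _ e → e) x) (∑-member≤length M L) ⟩
    1 + length L                                    ∎
    where
    open ≤-Reasoning
    pointwise : ∀ i → ⟦ i ∈? x ∷ L ⟧ ≤ ⟦ i ≟ x ⟧ + ⟦ i ∈? L ⟧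
    pointwise i = ⟦⟧-≤ (i ∈? x ∷ L) λ where
      (here e)    → ≤-trans (≤-reflexive (sym (⟦⟧-yes (i ≟ x) e))) (m≤m+n _ _)
      (there i∈L) → ≤-trans (≤-reflexive (sym (⟦⟧-yes (i ∈? L) i∈L))) (m≤n+m _ _)

  -- With c indices in χ the product is A^c B^(m - c); the extra power of `B` on both sides avoids
  -- the subtraction.
  ∏-if : ∀ m (χ : ℕ → Bool) A B →
         ∏ m (λ i → if χ i then A else B) * B ^ ∑ m (λ i → if χ i then 1 else 0)
           ≡ A ^ ∑ m (λ i → if χ i then 1 else 0) * B ^ m
  ∏-if zero    χ A B = refl
  ∏-if (suc m) χ A B with χ m | ∏-if m χ A B
  ... | true  | IH = trans (l₁ A _ B _) (trans (cong (λ x → A * (B * x)) IH) (l₂ A B (A ^ ∑ m (λ i → if χ i then 1 else 0)) (B ^ m)))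
    where
    l₁ : ∀ a p b e → a * p * (b * e) ≡ a * (b * (p * e))
    l₁ = solve-∀
    l₂ : ∀ a b x y → a * (b * (x * y)) ≡ a * x * (b * y)
    l₂ = solve-∀
  ... | false | IH = trans (*-assoc B _ _) (trans (cong (B *_) IH) (l₂ B (A ^ ∑ m (λ i → if χ i then 1 else 0)) (B ^ m)))
    where
    l₂ : ∀ b x y → b * (x * y) ≡ x * (b * y)
    l₂ = solve-∀

  -- The reverse Bernoulli bound (1 + y/a)^m ≤ 1 + 2my/a, valid while 2my ≤ a, with denominators
  -- cleared. That hypothesis absorbs the quadratic term of the induction step.
  bernoulli : ∀ a y m → 2 * (m * y) ≤ a → (a + y) ^ m * a ≤ a ^ m * (a + 2 * (m * y))
  bernoulli a y zero    h = ≤-reflexive (cong (1 *_) (sym (+-identityʳ a)))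
  bernoulli a y (suc m) h = begin
    (a + y) * (a + y) ^ m * a                       ≡⟨ *-assoc (a + y) _ a ⟩
    (a + y) * ((a + y) ^ m * a)                     ≤⟨ *-monoʳ-≤ (a + y) (bernoulli a y m h′) ⟩
    (a + y) * (a ^ m * (a + 2 * (m * y)))           ≡⟨ l₁ a y (a ^ m) m ⟩
    a ^ m * (a * a + a * (2 * (m * y)) + a * y + y * (2 * (m * y)))
      ≤⟨ *-monoʳ-≤ (a ^ m) (+-monoʳ-≤ (a * a + a * (2 * (m * y)) + a * y) (*-monoʳ-≤ y h′)) ⟩
    a ^ m * (a * a + a * (2 * (m * y)) + a * y + y * a)  ≡⟨ l₂ a y (a ^ m) m ⟩
    a * a ^ m * (a + 2 * (suc m * y))               ∎
    where
    open ≤-Reasoning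
    h′ : 2 * (m * y) ≤ a
    h′ = ≤-trans (*-monoʳ-≤ 2 (m≤n+m (m * y) y)) h
    l₁ : ∀ a y p m → (a + y) * (p * (a + 2 * (m * y))) ≡ p * (a * a + a * (2 * (m * y)) + a * y + y * (2 * (m * y)))
    l₁ = solve-∀
    l₂ : ∀ a y p m → p * (a * a + a * (2 * (m * y)) + a * y + y * a) ≡ a * p * (a + 2 * (y + m * y))
    l₂ = solve-∀

  [a+y]^m≤2a^m : ∀ a y m .{{_ : NonZero a}} → 2 * (m * y) ≤ a → (a + y) ^ m ≤ 2 * a ^ m
  [a+y]^m≤2a^m a y m h = *-cancelʳ-≤ _ _ a (begin
    (a + y) ^ m * a               ≤⟨ bernoulli a y m h ⟩
    a ^ m * (a + 2 * (m * y))     ≤⟨ *-monoʳ-≤ (a ^ m) (+-monoʳ-≤ a h) ⟩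
    a ^ m * (a + a)               ≡⟨ lemma (a ^ m) a ⟩
    2 * a ^ m * a                 ∎)
    where
    open ≤-Reasoning
    lemma : ∀ p a → p * (a + a) ≡ 2 * p * a
    lemma = solve-∀

  -- Bernoulli's inequality 1 + m/k ≤ (1 + 1/k)^m with denominators cleared; at m = k it yields the
  -- factor 2.
  k^m[k+m]≤[1+k]^m*k : ∀ k m → k ^ m * (k + m) ≤ suc k ^ m * k
  k^m[k+m]≤[1+k]^m*k k zero = ≤-reflexive (cong (1 *_) (+-identityʳ k))
  k^m[k+m]≤[1+k]^m*k k (suc m) = begin
    k * k ^ m * (k + suc m)             ≤⟨ m≤m+n _ (k ^ m * m) ⟩
    k * k ^ m * (k + suc m) + k ^ m * m ≡⟨ lemma k m (k ^ m) ⟩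
    suc k * (k ^ m * (k + m))           ≤⟨ *-monoʳ-≤ (suc k) (k^m[k+m]≤[1+k]^m*k k m) ⟩
    suc k * (suc k ^ m * k)             ≡⟨ *-assoc (suc k) (suc k ^ m) k ⟨
    suc k ^ suc m * k                   ∎
    where
    open ≤-Reasoning
    lemma : ∀ k m p → k * p * (k + (1 + m)) + p * m ≡ (1 + k) * (p * (k + m))
    lemma = solve-∀

  2k^k≤[1+k]^k : ∀ k .{{_ : NonZero k}} → 2 * k ^ k ≤ suc k ^ k
  2k^k≤[1+k]^k k = *-cancelʳ-≤ _ _ k (subst (_≤ suc k ^ k * k) (lemma (k ^ k) k) (k^m[k+m]≤[1+k]^m*k k k))
    where
    lemma : ∀ p k → p * (k + k) ≡ 2 * p * k
    lemma = solve-∀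

  -- Every block of k factors 1 + 1/k is worth at least 2, and `o` contains `g` such blocks.
  2^g*k^o≤[1+k]^o : ∀ k g {o} .{{_ : NonZero k}} → g * k ≤ o → 2 ^ g * k ^ o ≤ suc k ^ o
  2^g*k^o≤[1+k]^o k zero    {o} h = ≤-trans (≤-reflexive (*-identityˡ (k ^ o))) (^-monoˡ-≤ o (n≤1+n k))
  2^g*k^o≤[1+k]^o k (suc g) {o} h with m≤n⇒∃[o]m+o≡n h
  ... | (d , refl) rewrite +-assoc k (g * k) d | ^-distribˡ-+-* k k (g * k + d) | ^-distribˡ-+-* (suc k) k (g * k + d) = begin
    2 * 2 ^ g * (k ^ k * k ^ (g * k + d))     ≡⟨ lemma 2 (2 ^ g) (k ^ k) _ ⟩
    2 * k ^ k * (2 ^ g * k ^ (g * k + d))     ≤⟨ *-mono-≤ (2k^k≤[1+k]^k k) (2^g*k^o≤[1+k]^o k g (m≤m+n (g * k) d)) ⟩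
    suc k ^ k * suc k ^ (g * k + d)           ∎
    where
    open ≤-Reasoning
    lemma : ∀ a b c d → a * b * (c * d) ≡ a * c * (b * d)
    lemma = solve-∀

  isHeads isTails : Coin → ℕ
  isHeads heads = 1
  isHeads _     = 0
  isTails tails = 1
  isTails _     = 0

  headsBetween : Flips → ℕ → ℕ → ℕ
  headsBetween st w s = isHeads (st w s) + isHeads (st s w)

  initial : Flips
  initial _ _ = unflipped

  module _ (M : ℕ) where

    headsInto : (ℕ → Bool) → Flips → ℕ → ℕ
    headsInto χ st w = ∑ M λ s → if χ s then headsBetween st w s else 0

    excess : ℕ → (ℕ → Bool) → Flips → ℕ → ℕ
    excess K χ st w = if χ w then 0 else headsInto χ st w ∸ K

    tailsWithin : (ℕ → Bool) → Flips → ℕ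
    tailsWithin χ st = ∑ M λ i → ∑ M λ j → if χ i ∧ χ j then isTails (st i j) else 0

  module _ (k M : ℕ) .{{_ : NonZero k}} where

    degreeWeight-≥ : ∀ c → 2 ^ isHeads c * k ≤ degreeWeight k c
    degreeWeight-≥ unflipped = ≤-trans (≤-reflexive (*-identityˡ k)) (n≤1+n k)
    degreeWeight-≥ heads     = ≤-refl
    degreeWeight-≥ tails     = ≤-reflexive (*-identityˡ k)

    pairWeight-≥ : ∀ st w s → 2 ^ headsBetween st w s * (k * k) ≤ pairWeight k st w s
    pairWeight-≥ st w s = begin
      2 ^ (a + b) * (k * k)           ≡⟨ cong (_* (k * k)) (^-distribˡ-+-* 2 a b) ⟩
      2 ^ a * 2 ^ b * (k * k)         ≡⟨ lemma (2 ^ a) (2 ^ b) k ⟩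
      2 ^ a * k * (2 ^ b * k)         ≤⟨ *-mono-≤ (degreeWeight-≥ (st w s)) (degreeWeight-≥ (st s w)) ⟩
      pairWeight k st w s             ∎
      where
      open ≤-Reasoning
      a = isHeads (st w s)
      b = isHeads (st s w)
      lemma : ∀ x y k → x * y * (k * k) ≡ x * k * (y * k)
      lemma = solve-∀

    row-≥ : ∀ χ st w → 2 ^ headsInto M χ st w * (k * k) ^ M ≤ row k M χ st w
    row-≥ χ st w = begin
      2 ^ ∑ M e * (k * k) ^ M                       ≡⟨ cong₂ _*_ (∏-^-∑ M 2 e) (∏-const M (k * k)) ⟨
      ∏ M (λ s → 2 ^ e s) * ∏ M (λ _ → k * k)       ≡⟨ ∏-distrib-* M _ _ ⟨
      ∏ M (λ s → 2 ^ e s * (k * k))                 ≤⟨ ∏-mono M (λ s _ → entry s) ⟩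
      row k M χ st w                                ∎
      where
      open ≤-Reasoning
      e : ℕ → ℕ
      e s = if χ s then headsBetween st w s else 0
      entry : ∀ s → 2 ^ e s * (k * k) ≤ (if χ s then pairWeight k st w s else k * k)
      entry s with χ s
      ... | true  = pairWeight-≥ st w s
      ... | false = ≤-reflexive (*-identityˡ (k * k))

    excessPotential-≥ : ∀ K χ st → 2 ^ ∑ M (excess M K χ st) * (2 ^ K * (k * k) ^ M) ^ M
                                     ≤ excessPotential k M (2 ^ K * (k * k) ^ M) χ st
    excessPotential-≥ K χ st = begin
      2 ^ ∑ M e * Q ^ M                        ≡⟨ cong₂ _*_ (∏-^-∑ M 2 e) (∏-const M Q) ⟨
      ∏ M (λ w → 2 ^ e w) * ∏ M (λ _ → Q)      ≡⟨ ∏-distrib-* M _ _ ⟨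
      ∏ M (λ w → 2 ^ e w * Q)                  ≤⟨ ∏-mono M (λ w _ → factor w) ⟩
      excessPotential k M Q χ st               ∎
      where
      open ≤-Reasoning
      Q = 2 ^ K * (k * k) ^ M
      e = excess M K χ st
      factor : ∀ w → 2 ^ e w * Q ≤ (if χ w then Q else Q + row k M χ st w)
      factor w with χ w
      ... | true = ≤-reflexive (*-identityˡ Q)
      ... | false with ≤-total (headsInto M χ st w) K
      ...   | inj₁ d≤K rewrite m≤n⇒m∸n≡0 d≤K = ≤-trans (≤-reflexive (*-identityˡ Q)) (m≤m+n Q _)
      ...   | inj₂ K≤d = ≤-trans (≤-trans (≤-reflexive (trans (sym (*-assoc (2 ^ (d ∸ K)) (2 ^ K) _))
                          (cong (_* (k * k) ^ M) (trans (sym (^-distribˡ-+-* 2 (d ∸ K) K)) (cong (2 ^_) (m∸n+n≡m K≤d))))))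
                          (row-≥ χ st w)) (m≤n+m _ Q)
        where d = headsInto M χ st w

    -- In the absence of heads each tails in the set contributes 1 + 1/k; the power of `k` on the
    -- right clears the denominators.
    independentPotential-≥ : ∀ χ st → (∀ i j → χ i ≡ true → χ j ≡ true → st i j ≢ heads) →
      suc k ^ tailsWithin M χ st * (k ^ M) ^ M ≤ independentPotential k M χ st * k ^ tailsWithin M χ st
    independentPotential-≥ χ st indep = begin
      suc k ^ ∑ M r * (k ^ M) ^ M
        ≡⟨ cong₂ _*_ (∏-^-∑ M (suc k) r) (∏-const M (k ^ M)) ⟨
      ∏ M (λ i → suc k ^ r i) * ∏ M (λ _ → k ^ M)                ≡⟨ ∏-distrib-* M _ _ ⟨
      ∏ M (λ i → suc k ^ r i * k ^ M)                            ≤⟨ ∏-mono M (λ i _ → line i) ⟩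
      ∏ M (λ i → ∏ M (λ j → z i j) * k ^ r i)                    ≡⟨ ∏-distrib-* M _ _ ⟩
      independentPotential k M χ st * ∏ M (λ i → k ^ r i)
        ≡⟨ cong (independentPotential k M χ st *_) (∏-^-∑ M k r) ⟩
      independentPotential k M χ st * k ^ tailsWithin M χ st       ∎
      where
      open ≤-Reasoning
      t z : ℕ → ℕ → ℕ
      t i j = if χ i ∧ χ j then isTails (st i j) else 0
      z i j = if χ i ∧ χ j then tailsWeight k (st i j) else k
      r : ℕ → ℕ
      r i = ∑ M (t i)
      entry : ∀ i j → suc k ^ t i j * k ≤ z i j * k ^ t i j
      entry i j with χ i in χi | χ j in χj
      ... | false | _     = ≤-reflexive (*-comm 1 k)
      ... | true  | false = ≤-reflexive (*-comm 1 k)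
      ... | true  | true with st i j in stij
      ...   | unflipped = ≤-reflexive (*-comm 1 k)
      ...   | heads     = contradiction stij (indep i j χi χj)
      ...   | tails     = ≤-reflexive (cong₂ _*_ (*-identityʳ (suc k)) (sym (*-identityʳ k)))
      line : ∀ i → suc k ^ r i * k ^ M ≤ ∏ M (z i) * k ^ r i
      line i = begin
        suc k ^ r i * k ^ M                               ≡⟨ cong₂ _*_ (∏-^-∑ M (suc k) (t i)) (∏-const M k) ⟨
        ∏ M (λ j → suc k ^ t i j) * ∏ M (λ _ → k)         ≡⟨ ∏-distrib-* M _ _ ⟨
        ∏ M (λ j → suc k ^ t i j * k)                     ≤⟨ ∏-mono M (λ j _ → entry i j) ⟩
        ∏ M (λ j → z i j * k ^ t i j)                     ≡⟨ ∏-distrib-* M _ _ ⟩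
        ∏ M (z i) * ∏ M (λ j → k ^ t i j)                 ≡⟨ cong (∏ M (z i) *_) (∏-^-∑ M k (t i)) ⟩
        ∏ M (z i) * k ^ r i                               ∎

    -- Each member of χ contributes (1 + 1/k)² at the start. A list with repetitions may have fewer
    -- than `n` members, and the missing ones are padded by factors (1 + 1/k)² ≥ 1.
    row-initial : ∀ n χ w → ∑ M (λ i → if χ i then 1 else 0) ≤ n →
                  row k M χ initial w * (k * k) ^ n ≤ (suc k * suc k) ^ n * (k * k) ^ M
    row-initial n χ w c≤n with m≤n⇒∃[o]m+o≡n c≤n
    ... | (d , refl) = begin
      R * B ^ (c + d)             ≡⟨ cong (R *_) (^-distribˡ-+-* B c d) ⟩
      R * (B ^ c * B ^ d)         ≡⟨ *-assoc R (B ^ c) (B ^ d) ⟨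
      R * B ^ c * B ^ d           ≡⟨ cong (_* B ^ d) (∏-if M χ A B) ⟩
      A ^ c * B ^ M * B ^ d       ≤⟨ *-monoʳ-≤ (A ^ c * B ^ M) (^-monoˡ-≤ d (*-mono-≤ (n≤1+n k) (n≤1+n k))) ⟩
      A ^ c * B ^ M * A ^ d       ≡⟨ lemma (A ^ c) (B ^ M) (A ^ d) ⟩
      A ^ c * A ^ d * B ^ M       ≡⟨ cong (_* B ^ M) (^-distribˡ-+-* A c d) ⟨
      A ^ (c + d) * B ^ M         ∎
      where
      open ≤-Reasoning
      A = suc k * suc k
      B = k * k
      R = row k M χ initial w
      c = ∑ M (λ i → if χ i then 1 else 0)
      lemma : ∀ x y z → x * y * z ≡ x * z * y
      lemma = solve-∀

  fair-∑ᴸ : ∀ k n M {g : Coin → List ℕ → ℕ} → (∀ L → Fair k (λ c → g c L)) → Fair k (λ c → ∑ᴸ n M (g c))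
  fair-∑ᴸ k zero    M h = h []
  fair-∑ᴸ k (suc n) M {g} h =
    fair-∑ k M {λ c i → ∑ᴸ n M λ L → g c (i ∷ L)} λ i → fair-∑ᴸ k n M {λ c L → g c (i ∷ L)} λ L → h (i ∷ L)

  module _ (k M : ℕ) {st st′ : Flips} (eq : ∀ a b → st a b ≡ st′ a b) where

    row-cong : ∀ χ w → row k M χ st w ≡ row k M χ st′ w
    row-cong χ w = ∏-cong M λ s → cong₂ (λ x y → if χ s then degreeWeight k x * degreeWeight k y else k * k) (eq w s) (eq s w)

    excessPotential-cong : ∀ Q χ → excessPotential k M Q χ st ≡ excessPotential k M Q χ st′
    excessPotential-cong Q χ = ∏-cong M λ w → cong (λ x → if χ w then Q else Q + x) (row-cong χ w)

    independentPotential-cong : ∀ χ → independentPotential k M χ st ≡ independentPotential k M χ st′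
    independentPotential-cong χ =
      ∏-cong M λ i → ∏-cong M λ j → cong (λ x → if χ i ∧ χ j then tailsWeight k x else k) (eq i j)

  ^-cancelʳ-< : ∀ b .{{_ : NonZero b}} {m n} → b ^ m < b ^ n → m < n
  ^-cancelʳ-< b {m} {n} lt with m <? n
  ... | yes m<n = m<n
  ... | no m≮n = contradiction (^-monoʳ-≤ b (≮⇒≥ m≮n)) (<⇒≱ lt)

  -- The combined potential and the bounds it enforces

  module _ (k M n K E g : ℕ) .{{_ : NonZero k}} where

    -- The three thresholds belong to a red degree reaching `k`, a total excess reaching `E`, and g
    -- · k tails inside a set without heads. The quotient Φ / T is Φ₁/t₁ + Φ₂/t₂ + Φ₃/t₃, so Φ < T
    -- says that the union bound is below 1.
    Q t₁ t₂ t₃ T : ℕ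
    Q  = 2 ^ K * (k * k) ^ M
    t₁ = 2 ^ k * (k * k) ^ M
    t₂ = 2 ^ E * Q ^ M
    t₃ = 2 ^ g * (k ^ M) ^ M
    T  = t₁ * t₂ * t₃

    Φ₁ Φ₂ Φ₃ Φ : Flips → ℕ
    Φ₁ st = ∑ M (degreePotential k M st)
    Φ₂ st = ∑ᴸ n M λ L → excessPotential k M Q (member L) st
    Φ₃ st = ∑ᴸ n M λ L → independentPotential k M (member L) st
    Φ st = t₂ * t₃ * Φ₁ st + (t₁ * t₃ * Φ₂ st + t₁ * t₂ * Φ₃ st)

    Q≢0 : NonZero Q
    Q≢0 = m*n≢0 (2 ^ K) _ {{m^n≢0 2 K}} {{m^n≢0 (k * k) M {{m*n≢0 k k}}}}

    T≢0 : NonZero T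
    T≢0 = m*n≢0 (t₁ * t₂) t₃ {{m*n≢0 t₁ t₂
        {{m*n≢0 (2 ^ k) _ {{m^n≢0 2 k}} {{m^n≢0 (k * k) M {{m*n≢0 k k}}}}}}
        {{m*n≢0 (2 ^ E) _ {{m^n≢0 2 E}} {{m^n≢0 Q M {{Q≢0}}}}}}}}
      {{m*n≢0 (2 ^ g) _ {{m^n≢0 2 g}} {{m^n≢0 (k ^ M) M {{m^n≢0 k M}}}}}}

    -- Overwriting a cell with its own value gives flips that agree with the old ones only
    -- pointwise; this lets Φ ignore the difference.
    Φ-cong : ∀ {st st′} → (∀ a b → st a b ≡ st′ a b) → Φ st ≡ Φ st′
    Φ-cong eq = cong₂ (λ x y → t₂ * t₃ * x + y) (∑-cong M (row-cong k M eq (λ _ → true)))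
      (cong₂ (λ x y → t₁ * t₃ * x + t₁ * t₂ * y)
        (∑ᴸ-cong n M λ L → excessPotential-cong k M eq Q (member L))
        (∑ᴸ-cong n M λ L → independentPotential-cong k M eq (member L)))

    Φ-fair : ∀ st {i j} → i ≢ j → Fair k (λ c → Φ (st [ i , j ↦ c ]))
    Φ-fair st {i} {j} i≢j =
      fair-+ k {λ c → t₂ * t₃ * Φ₁ (flip c)} {λ c → t₁ * t₃ * Φ₂ (flip c) + t₁ * t₂ * Φ₃ (flip c)}
        (fair-*ˡ k (t₂ * t₃) {λ c → Φ₁ (flip c)}
          (fair-∑ k M {λ c → degreePotential k M (flip c)} (row-fair k M st i≢j (λ _ → true))))
        (fair-+ k {λ c → t₁ * t₃ * Φ₂ (flip c)} {λ c → t₁ * t₂ * Φ₃ (flip c)}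
          (fair-*ˡ k (t₁ * t₃) {λ c → Φ₂ (flip c)}
            (fair-∑ᴸ k n M {λ c L → excessPotential k M Q (member L) (flip c)} λ L → excessPotential-fair k M st i≢j Q (member L)))
          (fair-*ˡ k (t₁ * t₂) {λ c → Φ₃ (flip c)}
            (fair-∑ᴸ k n M {λ c L → independentPotential k M (member L) (flip c)} λ L → independentPotential-fair k M st i≢j (member L))))
      where
      flip : Coin → Flips
      flip c = st [ i , j ↦ c ]

    -- If both outcomes brought Φ up to `T`, so would their weighted average, which does not exceed
    -- the present value.
    flip-small : ∀ st {i j} → i ≢ j → st i j ≡ unflipped → Φ st < T →
                 Φ (st [ i , j ↦ heads ]) < T ⊎ Φ (st [ i , j ↦ tails ]) < T
    flip-small st {i} {j} i≢j idle Φ<T with Φ (st [ i , j ↦ heads ]) <? T | Φ (st [ i , j ↦ tails ]) <? T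
    ... | yes h | _     = inj₁ h
    ... | no _  | yes t = inj₂ t
    ... | no h  | no t  = contradiction (begin-strict
      suc k * T                                                       ≤⟨ +-mono-≤ (≮⇒≥ h) (*-monoʳ-≤ k (≮⇒≥ t)) ⟩
      Φ (st [ i , j ↦ heads ]) + k * Φ (st [ i , j ↦ tails ])         ≤⟨ Fair.average (Φ-fair st i≢j) ⟩
      suc k * Φ (st [ i , j ↦ unflipped ])                            ≡⟨ cong (suc k *_) (Φ-cong unchanged) ⟩
      suc k * Φ st                                                    <⟨ *-monoʳ-< (suc k) Φ<T ⟩
      suc k * T                                                       ∎) (<-irrefl refl)
      where
      open ≤-Reasoning
      unchanged : ∀ a b → (st [ i , j ↦ unflipped ]) a b ≡ st a b
      unchanged a b = update-cases st i j a b λ { refl refl → sym idle }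

    Φ₁<t₁ : ∀ {st} → Φ st < T → Φ₁ st < t₁
    Φ₁<t₁ {st} Φ<T = *-cancelˡ-< (t₂ * t₃) _ _ (begin-strict
      t₂ * t₃ * Φ₁ st ≤⟨ m≤m+n (t₂ * t₃ * Φ₁ st) _ ⟩
      Φ st            <⟨ Φ<T ⟩
      T               ≡⟨ lemma t₁ t₂ t₃ ⟩
      t₂ * t₃ * t₁    ∎)
      where
      open ≤-Reasoning
      lemma : ∀ a b c → a * b * c ≡ b * c * a
      lemma = solve-∀

    Φ₂<t₂ : ∀ {st} → Φ st < T → Φ₂ st < t₂
    Φ₂<t₂ {st} Φ<T = *-cancelˡ-< (t₁ * t₃) _ _ (begin-strict
      t₁ * t₃ * Φ₂ st ≤⟨ ≤-trans (m≤m+n (t₁ * t₃ * Φ₂ st) _) (m≤n+m _ (t₂ * t₃ * Φ₁ st)) ⟩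
      Φ st            <⟨ Φ<T ⟩
      T               ≡⟨ lemma t₁ t₂ t₃ ⟩
      t₁ * t₃ * t₂    ∎)
      where
      open ≤-Reasoning
      lemma : ∀ a b c → a * b * c ≡ a * c * b
      lemma = solve-∀

    Φ₃<t₃ : ∀ {st} → Φ st < T → Φ₃ st < t₃
    Φ₃<t₃ {st} Φ<T = *-cancelˡ-< (t₁ * t₂) _ _ (begin-strict
      t₁ * t₂ * Φ₃ st ≤⟨ ≤-trans (m≤n+m _ (t₁ * t₃ * Φ₂ st)) (m≤n+m _ (t₂ * t₃ * Φ₁ st)) ⟩
      Φ st            <⟨ Φ<T ⟩
      T               ∎)
      where
      open ≤-Reasoning

    -- The hypotheses make each of the three quotients start at no more than 1/4, so their sum is at
    -- most 3/4.
    Φ-initial : 4 * (M * (suc k * suc k) ^ M) ≤ 2 ^ k * (k * k) ^ M →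
                2 * (M * (suc k * suc k) ^ n) ≤ 2 ^ K * (k * k) ^ n →
                8 * M ^ n ≤ 2 ^ E → 4 * M ^ n ≤ 2 ^ g → Φ initial < T
    Φ-initial h₁ h₂ h₃ h₄ = *-cancelˡ-< 4 _ _ (begin-strict
      4 * Φ initial
        ≡⟨ l₁ (t₂ * t₃) (t₁ * t₃) (t₁ * t₂) (Φ₁ initial) (Φ₂ initial) (Φ₃ initial) ⟩
      t₂ * t₃ * (4 * Φ₁ initial) + (t₁ * t₃ * (4 * Φ₂ initial) + t₁ * t₂ * (4 * Φ₃ initial))
        ≤⟨ +-mono-≤ (*-monoʳ-≤ (t₂ * t₃) b₁) (+-mono-≤ (*-monoʳ-≤ (t₁ * t₃) b₂) (*-monoʳ-≤ (t₁ * t₂) b₃)) ⟩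
      t₂ * t₃ * t₁ + (t₁ * t₃ * t₂ + t₁ * t₂ * t₃)
        ≡⟨ l₂ t₁ t₂ t₃ ⟩
      3 * T
        <⟨ *-monoˡ-< T {{T≢0}} (≤-refl {4}) ⟩
      4 * T ∎)
      where
      open ≤-Reasoning
      l₁ : ∀ a b c x y z → 4 * (a * x + (b * y + c * z)) ≡ a * (4 * x) + (b * (4 * y) + c * (4 * z))
      l₁ = solve-∀
      l₂ : ∀ a b c → b * c * a + (a * c * b + a * b * c) ≡ 3 * (a * b * c)
      l₂ = solve-∀
      b₁ : 4 * Φ₁ initial ≤ t₁
      b₁ = ≤-trans (*-monoʳ-≤ 4 (∑-≤-const M _ λ w _ → ≤-reflexive (∏-const M (suc k * suc k)))) h₁
      rows : ∀ L → length L ≡ n → ∀ w → 2 * (M * row k M (member L) initial w) ≤ Q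
      rows L len w = *-cancelʳ-≤ _ _ ((k * k) ^ n) {{m^n≢0 (k * k) n {{m*n≢0 k k}}}} (begin
        2 * (M * R) * (k * k) ^ n                            ≡⟨ l₃ M R ((k * k) ^ n) ⟩
        2 * (M * (R * (k * k) ^ n))
          ≤⟨ *-monoʳ-≤ 2 (*-monoʳ-≤ M (row-initial k M n (member L) w (subst (_ ≤_) len (∑-member≤length M L)))) ⟩
        2 * (M * ((suc k * suc k) ^ n * (k * k) ^ M))        ≡⟨ l₄ M ((suc k * suc k) ^ n) ((k * k) ^ M) ⟩
        2 * (M * (suc k * suc k) ^ n) * (k * k) ^ M          ≤⟨ *-monoˡ-≤ ((k * k) ^ M) h₂ ⟩
        2 ^ K * (k * k) ^ n * (k * k) ^ M                    ≡⟨ l₅ (2 ^ K) ((k * k) ^ n) ((k * k) ^ M) ⟩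
        Q * (k * k) ^ n                                      ∎)
        where
        R = row k M (member L) initial w
        l₃ : ∀ a b c → 2 * (a * b) * c ≡ 2 * (a * (b * c))
        l₃ = solve-∀
        l₄ : ∀ a b c → 2 * (a * (b * c)) ≡ 2 * (a * b) * c
        l₄ = solve-∀
        l₅ : ∀ a b c → a * b * c ≡ a * c * b
        l₅ = solve-∀
      b₂ : 4 * Φ₂ initial ≤ t₂
      b₂ = begin
        4 * Φ₂ initial            ≤⟨ *-monoʳ-≤ 4 (∑ᴸ-≤ n M each) ⟩
        4 * (M ^ n * (2 * Q ^ M)) ≡⟨ l₆ (M ^ n) (Q ^ M) ⟩
        8 * M ^ n * Q ^ M         ≤⟨ *-monoˡ-≤ (Q ^ M) h₃ ⟩
        t₂                        ∎
        where
        l₆ : ∀ a b → 4 * (a * (2 * b)) ≡ 8 * a * b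
        l₆ = solve-∀
        each : ∀ L → length L ≡ n → excessPotential k M Q (member L) initial ≤ 2 * Q ^ M
        each L len = ≤-trans (∏-≤-const M (Q + R) λ w _ → factor w) ([a+y]^m≤2a^m Q R M {{Q≢0}} (rows L len 0))
          where
          -- With no coin flipped a row computes to the same product for every index, so row 0
          -- represents them all.
          R = row k M (member L) initial 0
          factor : ∀ w → (if member L w then Q else Q + R) ≤ Q + R
          factor w with member L w
          ... | true  = m≤m+n Q R
          ... | false = ≤-refl
      b₃ : 4 * Φ₃ initial ≤ t₃
      b₃ = begin
        4 * Φ₃ initial                  ≤⟨ *-monoʳ-≤ 4 (∑ᴸ-≤ n M λ L _ → each L) ⟩
        4 * (M ^ n * (k ^ M) ^ M)       ≡⟨ *-assoc 4 (M ^ n) _ ⟨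
        4 * M ^ n * (k ^ M) ^ M         ≤⟨ *-monoˡ-≤ ((k ^ M) ^ M) h₄ ⟩
        t₃                              ∎
        where
        entry : ∀ L i j → (if member L i ∧ member L j then k else k) ≤ k
        entry L i j with member L i ∧ member L j
        ... | true  = ≤-refl
        ... | false = ≤-refl
        each : ∀ L → independentPotential k M (member L) initial ≤ (k ^ M) ^ M
        each L = ∏-≤-const M (k ^ M) λ i _ → ∏-≤-const M k λ j _ → entry L i j

    degree<k : ∀ {st} → Φ st < T → ∀ {w} → w < M → headsInto M (λ _ → true) st w < k
    degree<k {st} Φ<T {w} w<M = ^-cancelʳ-< 2 (*-cancelʳ-< ((k * k) ^ M) _ _ (begin-strict
      2 ^ headsInto M (λ _ → true) st w * (k * k) ^ M ≤⟨ row-≥ k M (λ _ → true) st w ⟩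
      degreePotential k M st w                       ≤⟨ term≤∑ (degreePotential k M st) w<M ⟩
      Φ₁ st                                          <⟨ Φ₁<t₁ Φ<T ⟩
      t₁                                             ∎))
      where open ≤-Reasoning

    excess<E : ∀ {st} → Φ st < T → ∀ {L} → length L ≡ n → All (_< M) L → ∑ M (excess M K (member L) st) < E
    excess<E {st} Φ<T {L} refl L<M = ^-cancelʳ-< 2 (*-cancelʳ-< (Q ^ M) _ _ (begin-strict
      2 ^ ∑ M (excess M K (member L) st) * Q ^ M     ≤⟨ excessPotential-≥ k M K (member L) st ⟩
      excessPotential k M Q (member L) st            ≤⟨ term≤∑ᴸ (λ L → excessPotential k M Q (member L) st) L<M ⟩
      Φ₂ st                                          <⟨ Φ₂<t₂ Φ<T ⟩
      t₂                                             ∎))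
      where open ≤-Reasoning

    -- With g · k tails the factors 1 + 1/k would multiply to at least 2^g, more than the threshold
    -- `t₃` allows.
    tails<g*k : ∀ {st} → Φ st < T → ∀ {L} → length L ≡ n → All (_< M) L →
                (∀ i j → member L i ≡ true → member L j ≡ true → st i j ≢ heads) →
                tailsWithin M (member L) st < g * k
    tails<g*k {st} Φ<T {L} refl L<M indep with tailsWithin M (member L) st <? g * k
    ... | yes o<gk = o<gk
    ... | no o≮gk = contradiction (begin-strict
      2 ^ g * k ^ o * (k ^ M) ^ M
        ≤⟨ *-monoˡ-≤ ((k ^ M) ^ M) (2^g*k^o≤[1+k]^o k g (≮⇒≥ o≮gk)) ⟩
      suc k ^ o * (k ^ M) ^ M                                 ≤⟨ independentPotential-≥ k M (member L) st indep ⟩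
      independentPotential k M (member L) st * k ^ o
        ≤⟨ *-monoˡ-≤ (k ^ o) (term≤∑ᴸ (λ L → independentPotential k M (member L) st) L<M) ⟩
      Φ₃ st * k ^ o                                           <⟨ *-monoˡ-< (k ^ o) {{m^n≢0 k o}} (Φ₃<t₃ Φ<T) ⟩
      t₃ * k ^ o                                              ≡⟨ lemma (2 ^ g) ((k ^ M) ^ M) (k ^ o) ⟩
      2 ^ g * k ^ o * (k ^ M) ^ M                             ∎) (<-irrefl refl)
      where
      open ≤-Reasoning
      o = tailsWithin M (member L) st
      lemma : ∀ a b c → a * b * c ≡ a * c * b
      lemma = solve-∀

  -- Boards

  degree : Board → Vertex → ℕ
  degree []                x = 0
  degree ((u , v , _) ∷ B) x = ⟦ x ≟ u ⟧ + ⟦ x ≟ v ⟧ + degree B x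

  Loopless : Board → Set
  Loopless B = ∀ {c x y} → Edge B c x y → x ≢ y

  weaken : ∀ {e B c x y} → Edge B c x y → Edge (e ∷ B) c x y
  weaken = map⊎ there there

  SamePair : Vertex → Vertex → Vertex → Vertex → Set
  SamePair u v x y = (x ≡ u × y ≡ v) ⊎ (x ≡ v × y ≡ u)

  edge-∷⁻ : ∀ {u v c B c′ x y} → Edge ((u , v , c) ∷ B) c′ x y → (c′ ≡ c × SamePair u v x y) ⊎ Edge B c′ x y
  edge-∷⁻ (inj₁ (here refl)) = inj₁ (refl , inj₁ (refl , refl))
  edge-∷⁻ (inj₂ (here refl)) = inj₁ (refl , inj₂ (refl , refl))
  edge-∷⁻ (inj₁ (there e))   = inj₂ (inj₁ e)
  edge-∷⁻ (inj₂ (there e))   = inj₂ (inj₂ e)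

  samePair-sym : ∀ {u v x y} → SamePair u v x y → SamePair u v y x
  samePair-sym (inj₁ (p , q)) = inj₂ (q , p)
  samePair-sym (inj₂ (p , q)) = inj₁ (q , p)

  samePair-trans : ∀ {u v x y z} → u ≢ v → SamePair u v x y → SamePair u v y z → x ≡ z
  samePair-trans u≢v (inj₁ (refl , refl)) (inj₁ (e , _))       = contradiction (sym e) u≢v
  samePair-trans u≢v (inj₁ (refl , refl)) (inj₂ (_ , refl))    = refl
  samePair-trans u≢v (inj₂ (refl , refl)) (inj₁ (_ , refl))    = refl
  samePair-trans u≢v (inj₂ (refl , refl)) (inj₂ (e , _))       = contradiction e u≢v

  samePair-edge⁻ : ∀ {u v B c x y} → SamePair u v x y → Edge B c x y → Edge B c u v
  samePair-edge⁻ (inj₁ (refl , refl)) e = e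
  samePair-edge⁻ (inj₂ (refl , refl)) e = swap e

  loopless-∷ : ∀ {u v c B} → u ≢ v → Loopless B → Loopless ((u , v , c) ∷ B)
  loopless-∷ u≢v ll e = case edge-∷⁻ e of λ where
    (inj₁ (_ , inj₁ (refl , refl))) → u≢v
    (inj₁ (_ , inj₂ (refl , refl))) → u≢v ∘ sym
    (inj₂ e′)                       → ll e′

  Unicoloured : Board → Set
  Unicoloured B = ∀ {x y} → Edge B red x y → ¬ Edge B blue x y

  unicoloured-∷ : ∀ {u v c B} → ¬ Adjacent B u v → Unicoloured B → Unicoloured ((u , v , c) ∷ B)
  unicoloured-∷ {u} {v} {c} {B} ¬adj uni r b with edge-∷⁻ r | edge-∷⁻ b
  ... | inj₁ (refl , _) | inj₁ (() , _)
  ... | inj₁ (_ , p)    | inj₂ b′       = ¬adj (blue , samePair-edge⁻ p b′)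
  ... | inj₂ r′         | inj₁ (_ , p)  = ¬adj (red , samePair-edge⁻ p r′)
  ... | inj₂ r′         | inj₂ b′       = uni r′ b′

  RedTriangleFree : Board → Set
  RedTriangleFree B = ∀ {x y z} → Edge B red x y → Edge B red y z → ¬ Edge B red x z

  RedPath : Board → Vertex → Vertex → Set
  RedPath B x y = ∃[ w ] Edge B red w x × Edge B red w y

  samePair-path : ∀ {u v B x y w} → SamePair u v x y → Edge B red w x → Edge B red w y → RedPath B u v
  samePair-path (inj₁ (refl , refl)) e e′ = _ , e , e′
  samePair-path (inj₂ (refl , refl)) e e′ = _ , e′ , e

  triangleFree-blue : ∀ {u v B} → RedTriangleFree B → RedTriangleFree ((u , v , blue) ∷ B)
  triangleFree-blue tf e₁ e₂ e₃ with edge-∷⁻ e₁ | edge-∷⁻ e₂ | edge-∷⁻ e₃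
  ... | inj₂ e₁′ | inj₂ e₂′ | inj₂ e₃′ = tf e₁′ e₂′ e₃′
  ... | inj₁ (() , _) | _ | _
  ... | _ | inj₁ (() , _) | _
  ... | _ | _ | inj₁ (() , _)

  -- Two sides lying on the new edge would make the third side a loop. With exactly one new side,
  -- the two old ones form a red path between its ends.
  triangleFree-red : ∀ {u v B} → u ≢ v → Loopless B → ¬ RedPath B u v → RedTriangleFree B →
                     RedTriangleFree ((u , v , red) ∷ B)
  triangleFree-red {u} {v} {B} u≢v ll ¬path tf {x} {y} {z} e₁ e₂ e₃ with edge-∷⁻ e₁ | edge-∷⁻ e₂ | edge-∷⁻ e₃
  ... | inj₂ e₁′ | inj₂ e₂′ | inj₂ e₃′ = tf e₁′ e₂′ e₃′
  ... | inj₁ (_ , p) | inj₁ (_ , q) | _ = loopless-∷ u≢v ll e₃ (samePair-trans u≢v p q)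
  ... | inj₁ (_ , p) | inj₂ _ | inj₁ (_ , q) = loopless-∷ u≢v ll e₂ (samePair-trans u≢v (samePair-sym p) q)
  ... | inj₂ _ | inj₁ (_ , p) | inj₁ (_ , q) = loopless-∷ u≢v ll e₁ (samePair-trans u≢v q (samePair-sym p))
  ... | inj₁ (_ , p) | inj₂ e₂′ | inj₂ e₃′ = ¬path (samePair-path p (swap e₃′) (swap e₂′))
  ... | inj₂ e₁′ | inj₁ (_ , p) | inj₂ e₃′ = ¬path (samePair-path p e₁′ e₃′)
  ... | inj₂ e₁′ | inj₂ e₂′ | inj₁ (_ , p) = ¬path (samePair-path p (swap e₁′) e₂′)

  degree-∷-other : ∀ {u v c} B {x} → x ≢ u → x ≢ v → degree ((u , v , c) ∷ B) x ≡ degree B x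
  degree-∷-other {u} {v} B {x} x≢u x≢v rewrite ⟦⟧-no (x ≟ u) x≢u | ⟦⟧-no (x ≟ v) x≢v = refl

  ∑-degree≤ : ∀ {a name} B → InjectiveBelow a name → ∑ a (λ i → degree B (name i)) ≤ 2 * length B
  ∑-degree≤ {a} [] inj = ≤-reflexive (trans (∑-const a 0) (*-zeroʳ a))
  ∑-degree≤ {a} {name} ((u , v , _) ∷ B) inj = begin
    ∑ a (λ i → ⟦ name i ≟ u ⟧ + ⟦ name i ≟ v ⟧ + degree B (name i))
      ≡⟨ ∑-distrib-+ a (λ i → ⟦ name i ≟ u ⟧ + ⟦ name i ≟ v ⟧) _ ⟩
    ∑ a (λ i → ⟦ name i ≟ u ⟧ + ⟦ name i ≟ v ⟧) + ∑ a (λ i → degree B (name i))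
      ≡⟨ cong (_+ ∑ a (λ i → degree B (name i))) (∑-distrib-+ a _ _) ⟩
    ∑ a (λ i → ⟦ name i ≟ u ⟧) + ∑ a (λ i → ⟦ name i ≟ v ⟧) + ∑ a (λ i → degree B (name i))
      ≤⟨ +-mono-≤ (+-mono-≤ (∑-fibre≤1 a inj u) (∑-fibre≤1 a inj v)) (∑-degree≤ B inj) ⟩
    1 + 1 + 2 * length B
      ≡⟨ *-suc 2 (length B) ⟨
    2 * suc (length B) ∎
    where open ≤-Reasoning

  module _ (τ : ℕ) where

    -- The number of edges xy that were drawn while x had degree less than τ.
    early : Board → Vertex → Vertex → ℕ
    early []                x y = 0
    early ((u , v , _) ∷ B) x y =
      ⟦ degree B x <? τ ⟧ * (⟦ x ≟ u ⟧ * ⟦ y ≟ v ⟧ + ⟦ x ≟ v ⟧ * ⟦ y ≟ u ⟧) + early B x y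

    early-here : ∀ {u v x y} B c → SamePair u v x y → degree B x < τ → 1 ≤ early ((u , v , c) ∷ B) x y
    early-here {u} {v} {x} {y} B c p d<τ = ≤-trans (≤-trans (lower p)
      (≤-reflexive (trans (sym (*-identityˡ _)) (cong (_* pair) (sym (⟦⟧-yes (degree B x <? τ) d<τ)))))) (m≤m+n _ _)
      where
      pair : ℕ
      pair = ⟦ x ≟ u ⟧ * ⟦ y ≟ v ⟧ + ⟦ x ≟ v ⟧ * ⟦ y ≟ u ⟧
      lower : SamePair u v x y → 1 ≤ pair
      lower (inj₁ (e , e′)) rewrite ⟦⟧-yes (x ≟ u) e | ⟦⟧-yes (y ≟ v) e′ = s≤s z≤n
      lower (inj₂ (e , e′)) rewrite ⟦⟧-yes (x ≟ v) e | ⟦⟧-yes (y ≟ u) e′ = m≤n+m 1 (⟦ x ≟ u ⟧ * ⟦ y ≟ v ⟧)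

    degree-samePair : ∀ {u v x y} B c → SamePair u v x y → degree B x < degree ((u , v , c) ∷ B) x
    degree-samePair {u} {v} {x} B c (inj₁ (e , _)) rewrite ⟦⟧-yes (x ≟ u) e = s≤s (m≤n+m _ ⟦ x ≟ v ⟧)
    degree-samePair {u} {v} {x} B c (inj₂ (e , _)) rewrite ⟦⟧-yes (x ≟ v) e = +-monoˡ-≤ (degree B x) (m≤n+m 1 ⟦ x ≟ u ⟧)

    -- Degrees only grow, and drawing the edge itself raises the degree of `x`; hence the degree was
    -- strictly below τ before the edge, although the hypothesis is not strict.
    edge⇒early : ∀ B {c x y} → Edge B c x y → degree B x ≤ τ → 1 ≤ early B x y
    edge⇒early []      (inj₁ ()) _
    edge⇒early []      (inj₂ ()) _
    edge⇒early ((u , v , c) ∷ B) e d≤τ with edge-∷⁻ e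
    ... | inj₁ (_ , p) = early-here B c p (≤-trans (degree-samePair B c p) d≤τ)
    ... | inj₂ e′      = ≤-trans (edge⇒early B e′ (≤-trans (m≤n+m _ _) d≤τ)) (m≤n+m _ _)

    -- The second bound drives the first: an edge counts only while the degree of `x` is below τ,
    -- and then the old count, being at most that degree, has room for one more. Looplessness
    -- ensures that a new edge adds at most one.
    ∑-early : ∀ {m h} B x → Loopless B → InjectiveBelow m h →
              ∑ m (λ j → early B x (h j)) ≤ τ × ∑ m (λ j → early B x (h j)) ≤ degree B x
    ∑-early {m} [] x ll inj rewrite ∑-const m 0 | *-zeroʳ m = z≤n , z≤n
    ∑-early {m} {h} ((u , v , c) ∷ B) x ll inj with ∑-early {m} {h} B x (λ e → ll (weaken e)) inj
    ... | (≤τ , ≤deg) = bound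
      where
      open ≤-Reasoning
      s p : ℕ
      s = ∑ m (λ j → early B x (h j))
      p = ⟦ x ≟ u ⟧ + ⟦ x ≟ v ⟧
      p≤1 : p ≤ 1
      p≤1 with x ≟ u
      ... | no x≢u rewrite ⟦⟧-no (x ≟ u) x≢u = ⟦⟧≤1 (x ≟ v)
      ... | yes refl rewrite ⟦⟧-yes (x ≟ x) refl | ⟦⟧-no (x ≟ v) (ll {c} (inj₁ (here refl))) = ≤-refl
      total : ∑ m (λ j → early ((u , v , c) ∷ B) x (h j)) ≤ ⟦ degree B x <? τ ⟧ * p + s
      total = begin
        ∑ m (λ j → d * (⟦ x ≟ u ⟧ * ⟦ h j ≟ v ⟧ + ⟦ x ≟ v ⟧ * ⟦ h j ≟ u ⟧) + early B x (h j))
          ≡⟨ ∑-distrib-+ m (λ j → d * (⟦ x ≟ u ⟧ * ⟦ h j ≟ v ⟧ + ⟦ x ≟ v ⟧ * ⟦ h j ≟ u ⟧)) _ ⟩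
        ∑ m (λ j → d * (⟦ x ≟ u ⟧ * ⟦ h j ≟ v ⟧ + ⟦ x ≟ v ⟧ * ⟦ h j ≟ u ⟧)) + s
          ≡⟨ cong (_+ s) (∑-distribˡ-* m d _) ⟩
        d * ∑ m (λ j → ⟦ x ≟ u ⟧ * ⟦ h j ≟ v ⟧ + ⟦ x ≟ v ⟧ * ⟦ h j ≟ u ⟧) + s
          ≡⟨ cong (λ q → d * q + s) (∑-distrib-+ m (λ j → ⟦ x ≟ u ⟧ * ⟦ h j ≟ v ⟧) _) ⟩
        d * (∑ m (λ j → ⟦ x ≟ u ⟧ * ⟦ h j ≟ v ⟧) + ∑ m (λ j → ⟦ x ≟ v ⟧ * ⟦ h j ≟ u ⟧)) + s
          ≡⟨ cong₂ (λ q q′ → d * (q + q′) + s) (∑-distribˡ-* m ⟦ x ≟ u ⟧ _) (∑-distribˡ-* m ⟦ x ≟ v ⟧ _) ⟩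
        d * (⟦ x ≟ u ⟧ * ∑ m (λ j → ⟦ h j ≟ v ⟧) + ⟦ x ≟ v ⟧ * ∑ m (λ j → ⟦ h j ≟ u ⟧)) + s
          ≤⟨ +-monoˡ-≤ s (*-monoʳ-≤ d (+-mono-≤ (*-monoʳ-≤ ⟦ x ≟ u ⟧ (∑-fibre≤1 m inj v)) (*-monoʳ-≤ ⟦ x ≟ v ⟧ (∑-fibre≤1 m inj u)))) ⟩
        d * (⟦ x ≟ u ⟧ * 1 + ⟦ x ≟ v ⟧ * 1) + s
          ≡⟨ cong₂ (λ q q′ → d * (q + q′) + s) (*-identityʳ ⟦ x ≟ u ⟧) (*-identityʳ ⟦ x ≟ v ⟧) ⟩
        d * p + s ∎
        where d = ⟦ degree B x <? τ ⟧
      bound : ∑ m (λ j → early ((u , v , c) ∷ B) x (h j)) ≤ τ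
            × ∑ m (λ j → early ((u , v , c) ∷ B) x (h j)) ≤ p + degree B x
      bound with degree B x <? τ
      ... | yes d<τ = ≤-trans total′ (≤-trans (+-mono-≤ p≤1 ≤deg) d<τ) , ≤-trans total′ (+-monoʳ-≤ p ≤deg)
        where
        total′ = ≤-trans total (≤-reflexive (cong (_+ s)
          (trans (cong (_* p) (⟦⟧-yes (degree B x <? τ) d<τ)) (*-identityˡ p))))
      ... | no d≮τ = ≤-trans total′ ≤τ , ≤-trans total′ (≤-trans ≤deg (m≤n+m _ p))
        where
        total′ = ≤-trans total (≤-reflexive (cong (λ d → d * p + s) (⟦⟧-no (degree B x <? τ) d≮τ)))

  -- Painter's strategy

  -- Excludes `unflipped`, so that a colour can be read off a coin and both outcomes are handled by
  -- one construction.
  data Flipped : Coin → Set where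
    heads : Flipped heads
    tails : Flipped tails

  colour : ∀ {c} → Flipped c → Colour
  colour heads = red
  colour tails = blue

  Showing : ℕ → (ℕ → Vertex) → Flips → Coin → Vertex → Vertex → Set
  Showing a name flips c x y =
    ∃[ i ] ∃[ j ] (i < a × j < a) × (name i ≡ x × name j ≡ y) × (flips i j ≡ c ⊎ flips j i ≡ c)

  module _ (τ k M n K E g : ℕ) .{{_ : NonZero k}} where

    -- The active vertices are name 0, …, name (a - 1), in the order in which they
    -- became active.
    record State (B : Board) : Set where
      field
        a             : ℕ
        name          : ℕ → Vertex
        flips         : Flips
        name-inj      : InjectiveBelow a name
        name-active   : ∀ {i} → i < a → τ ≤ degree B (name i)
        flips-drawn   : ∀ {i j} → flips i j ≢ unflipped → i < a × j < a × Adjacent B (name i) (name j)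
        heads-red     : ∀ {i j} → flips i j ≡ heads → Edge B red (name i) (name j)
        loopless      : Loopless B
        unicoloured   : Unicoloured B
        triangleFree  : RedTriangleFree B
        small         : Φ k M n K E g flips < T k M n K E g
        red-heads     : ∀ {x y} → Edge B red x y → Showing a name flips heads x y
        blue-cause    : ∀ {x y} → Edge B blue x y →
                        (1 ≤ early τ B x y ⊎ 1 ≤ early τ B y x) ⊎ Showing a name flips tails x y ⊎ RedPath B x y

      Named : Vertex → Set
      Named x = ∃[ i ] i < a × name i ≡ x

    open State

    -- Kept apart from `State` because it fails for a moment: an edge may raise its ends to degree τ
    -- before they have received an index.
    Covers : ∀ {B} → State B → Set
    Covers {B} S = ∀ {x} → τ ≤ degree B x → Named S x

    redPath-∷ : ∀ {e B x y} → RedPath B x y → RedPath (e ∷ B) x y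
    redPath-∷ (w , r , r′) = w , weaken r , weaken r′

    early-∷ : ∀ e B x y → 1 ≤ early τ B x y → 1 ≤ early τ (e ∷ B) x y
    early-∷ e B x y h = ≤-trans h (m≤n+m _ _)

    drawBlue : ∀ {B u v} → State B → u ≢ v → ¬ Adjacent B u v →
               (degree B u < τ ⊎ degree B v < τ) ⊎ RedPath B u v → State ((u , v , blue) ∷ B)
    drawBlue {B} {u} {v} S u≢v ¬adj why = record
      { a = a S ; name = name S ; flips = flips S ; name-inj = name-inj S
      ; name-active = λ i<a → ≤-trans (name-active S i<a) (m≤n+m _ _)
      ; flips-drawn = λ f → case flips-drawn S f of λ (i<a , j<a , c , e) → i<a , j<a , c , weaken e
      ; heads-red = weaken ∘ heads-red S
      ; loopless = loopless-∷ u≢v (loopless S)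
      ; unicoloured = unicoloured-∷ ¬adj (unicoloured S)
      ; triangleFree = triangleFree-blue (triangleFree S)
      ; small = small S
      ; red-heads = λ e → case edge-∷⁻ e of λ where
          (inj₁ (() , _))
          (inj₂ e′) → red-heads S e′
      ; blue-cause = λ {x} {y} e → case edge-∷⁻ e of λ where
          (inj₁ (_ , p)) → new p why
          (inj₂ e′)      → map⊎ (map⊎ (early-∷ (u , v , blue) B x y) (early-∷ (u , v , blue) B y x))
                                 (map⊎ (λ s → s) redPath-∷) (blue-cause S e′)
      }
      where
      B′ = (u , v , blue) ∷ B
      new : ∀ {x y} → SamePair u v x y → (degree B u < τ ⊎ degree B v < τ) ⊎ RedPath B u v →
            (1 ≤ early τ B′ x y ⊎ 1 ≤ early τ B′ y x) ⊎ Showing (a S) (name S) (flips S) tails x y ⊎ RedPath B′ x y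
      new p@(inj₁ (refl , refl)) (inj₁ (inj₁ d<τ)) = inj₁ (inj₁ (early-here τ B blue p d<τ))
      new p@(inj₁ (refl , refl)) (inj₁ (inj₂ d<τ)) = inj₁ (inj₂ (early-here τ B blue (samePair-sym p) d<τ))
      new p@(inj₂ (refl , refl)) (inj₁ (inj₁ d<τ)) = inj₁ (inj₂ (early-here τ B blue (samePair-sym p) d<τ))
      new p@(inj₂ (refl , refl)) (inj₁ (inj₂ d<τ)) = inj₁ (inj₁ (early-here τ B blue p d<τ))
      new (inj₁ (refl , refl)) (inj₂ path)           = inj₂ (inj₂ (redPath-∷ path))
      new (inj₂ (refl , refl)) (inj₂ (w , r , r′))   = inj₂ (inj₂ (redPath-∷ (w , r′ , r)))

    drawFlipped : ∀ {B i j c} (S : State B) (f : Flipped c) → i < a S → j < a S → name S i ≢ name S j →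
                  ¬ Adjacent B (name S i) (name S j) → flips S i j ≡ unflipped →
                  (c ≡ heads → ¬ RedPath B (name S i) (name S j)) →
                  Φ k M n K E g (flips S [ i , j ↦ c ]) < T k M n K E g →
                  State ((name S i , name S j , colour f) ∷ B)
    drawFlipped {B} {i} {j} {c} S f i<a j<a u≢v ¬adj idle ¬path small′ = record
      { a = a S ; name = name S ; flips = flips′ ; name-inj = name-inj S
      ; name-active = λ i<a → ≤-trans (name-active S i<a) (m≤n+m _ _)
      ; flips-drawn = drawn
      ; heads-red = isRed
      ; loopless = loopless-∷ u≢v (loopless S)
      ; unicoloured = unicoloured-∷ ¬adj (unicoloured S)
      ; triangleFree = tf f ¬path
      ; small = small′
      ; red-heads = λ e → case edge-∷⁻ e of λ where
          (inj₁ (eq , p)) → new p (isHeads′ f (sym eq))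
          (inj₂ e′)       → old (λ ()) (red-heads S e′)
      ; blue-cause = λ {x} {y} e → case edge-∷⁻ e of λ where
          (inj₁ (eq , p)) → inj₂ (inj₁ (new p (isTails′ f (sym eq))))
          (inj₂ e′)       → map⊎ (map⊎ (early-∷ (u , v , colour f) B x y) (early-∷ (u , v , colour f) B y x))
                                  (map⊎ (old λ ()) redPath-∷) (blue-cause S e′)
      }
      where
      u = name S i
      v = name S j
      flips′ = flips S [ i , j ↦ c ]
      B′ = (u , v , colour f) ∷ B
      drawn : ∀ {i′ j′} → flips′ i′ j′ ≢ unflipped → i′ < a S × j′ < a S × Adjacent B′ (name S i′) (name S j′)
      drawn {i′} {j′} fl with i′ ≟ i | j′ ≟ j
      ... | yes refl | yes refl = i<a , j<a , colour f , inj₁ (here refl)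
      ... | no i′≢i | _ = case flips-drawn S (λ e → fl (trans (update-missˡ (flips S) i′≢i) e)) of
                            λ (p , q , c′ , e) → p , q , c′ , weaken e
      ... | yes _ | no j′≢j = case flips-drawn S (λ e → fl (trans (update-missʳ (flips S) j′≢j) e)) of
                            λ (p , q , c′ , e) → p , q , c′ , weaken e
      isRed : ∀ {i′ j′} → flips′ i′ j′ ≡ heads → Edge B′ red (name S i′) (name S j′)
      isRed {i′} {j′} h with i′ ≟ i | j′ ≟ j
      ... | no i′≢i | _ = weaken (heads-red S (trans (sym (update-missˡ (flips S) i′≢i)) h))
      ... | yes _ | no j′≢j = weaken (heads-red S (trans (sym (update-missʳ (flips S) j′≢j)) h))
      ... | yes refl | yes refl = go f (trans (sym (update-hit (flips S) i j)) h)
        where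
        go : ∀ {c} (f : Flipped c) → c ≡ heads → Edge ((u , v , colour f) ∷ B) red u v
        go heads _ = inj₁ (here refl)
        go tails ()
      tf : ∀ {c} (f : Flipped c) → (c ≡ heads → ¬ RedPath B u v) → RedTriangleFree ((u , v , colour f) ∷ B)
      tf heads ¬path = triangleFree-red u≢v (loopless S) (¬path refl) (triangleFree S)
      tf tails _     = triangleFree-blue (triangleFree S)
      isHeads′ : ∀ {c} (f : Flipped c) → colour f ≡ red → c ≡ heads
      isHeads′ heads _ = refl
      isTails′ : ∀ {c} (f : Flipped c) → colour f ≡ blue → c ≡ tails
      isTails′ tails _ = refl
      new : ∀ {c′ x y} → SamePair u v x y → c ≡ c′ → Showing (a S) (name S) flips′ c′ x y
      new (inj₁ (refl , refl)) refl = i , j , (i<a , j<a) , (refl , refl) , inj₁ (update-hit (flips S) i j)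
      new (inj₂ (refl , refl)) refl = j , i , (j<a , i<a) , (refl , refl) , inj₂ (update-hit (flips S) i j)
      -- Earlier flips survive because the overwritten cell was still unflipped.
      keep : ∀ {c′ i′ j′} → c′ ≢ unflipped → flips S i′ j′ ≡ c′ → flips′ i′ j′ ≡ c′
      keep c′≢ e = trans (update-cases (flips S) i j _ _ λ { refl refl → contradiction (trans (sym e) idle) c′≢ }) e
      old : ∀ {c′ x y} → c′ ≢ unflipped → Showing (a S) (name S) (flips S) c′ x y → Showing (a S) (name S) flips′ c′ x y
      old c′≢ (i′ , j′ , bounds , names , s) = i′ , j′ , bounds , names , map⊎ (keep c′≢) (keep c′≢) s

    -- By `flips-drawn` no coin at index `a` has been flipped, so the new vertex can take that index
    -- with the flips, and hence the potential, unchanged.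
    activate : ∀ {B} (S : State B) x → ¬ Named S x → τ ≤ degree B x →
               ∃[ S′ ] Named S′ x × (∀ {y} → Named S y → Named {B} S′ y)
    activate {B} S x ¬named active = record
      { a = suc m ; name = name′ ; flips = flips S
      ; name-inj = inj
      ; name-active = act
      ; flips-drawn = λ f → case flips-drawn S f of λ (i<m , j<m , c , e) →
          m<n⇒m<1+n i<m , m<n⇒m<1+n j<m , c , subst₂ (Edge B c) (sym (old i<m)) (sym (old j<m)) e
      ; heads-red = λ h → case flips-drawn S (λ e → contradiction (trans (sym h) e) λ ()) of λ (i<m , j<m , _) →
          subst₂ (Edge B red) (sym (old i<m)) (sym (old j<m)) (heads-red S h)
      ; loopless = loopless S ; unicoloured = unicoloured S ; triangleFree = triangleFree S ; small = small S
      ; red-heads = showing ∘ red-heads S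
      ; blue-cause = λ e → map⊎ (λ z → z) (map⊎ showing (λ z → z)) (blue-cause S e)
      } , (m , ≤-refl , newest) , λ (i , i<m , e) → i , m<n⇒m<1+n i<m , trans (old i<m) e
      where
      m = a S
      name′ : ℕ → Vertex
      name′ i = if does (i ≟ m) then x else name S i
      newest : name′ m ≡ x
      newest rewrite dec-true (m ≟ m) refl = refl
      old : ∀ {i} → i < m → name′ i ≡ name S i
      old {i} i<m rewrite dec-false (i ≟ m) (<⇒≢ i<m) = refl
      split : ∀ {i} → i < suc m → i ≡ m ⊎ i < m
      split {i} i<1+m with i ≟ m
      ... | yes e = inj₁ e
      ... | no i≢m = inj₂ (≤∧≢⇒< (≤-pred i<1+m) i≢m)
      inj : InjectiveBelow (suc m) name′
      inj p q e with split p | split q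
      ... | inj₁ refl | inj₁ refl = refl
      ... | inj₁ refl | inj₂ j<m = contradiction (_ , j<m , trans (sym (old j<m)) (trans (sym e) newest)) ¬named
      ... | inj₂ i<m | inj₁ refl = contradiction (_ , i<m , trans (sym (old i<m)) (trans e newest)) ¬named
      ... | inj₂ i<m | inj₂ j<m = name-inj S i<m j<m (trans (sym (old i<m)) (trans e (old j<m)))
      act : ∀ {i} → i < suc m → τ ≤ degree B (name′ i)
      act p with split p
      ... | inj₁ refl = subst (λ y → τ ≤ degree B y) (sym newest) active
      ... | inj₂ i<m  = subst (λ y → τ ≤ degree B y) (sym (old i<m)) (name-active S i<m)
      showing : ∀ {c y z} → Showing m (name S) (flips S) c y z → Showing (suc m) name′ (flips S) c y z
      showing (i , j , (i<m , j<m) , (ey , ez) , s) =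
        i , j , (m<n⇒m<1+n i<m , m<n⇒m<1+n j<m) , (trans (old i<m) ey , trans (old j<m) ez) , s

    -- Indices already given are preserved, so this can be applied to both ends of an edge in turn.
    -- The double negation permits excluded middle on whether `x` has an index, and is discharged
    -- where the goal is absurdity.
    ensureNamed : ∀ {B} (S : State B) x →
                  ¬ ¬ (∃[ S′ ] (τ ≤ degree B x → Named S′ x) × (∀ {y} → Named S y → Named {B} S′ y))
    ensureNamed {B} S x ¬goal = ¬¬-excluded-middle λ where
      (yes named) → ¬goal (S , (λ _ → named) , λ z → z)
      (no ¬named) → case τ ≤? degree B x of λ where
        (no ¬active) → ¬goal (S , (λ active → contradiction active ¬active) , λ z → z)
        (yes active) → case activate S x ¬named active of λ (S′ , new , old) → ¬goal (S′ , (λ _ → new) , old)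

    -- Painter's strategy lies in the choice of which branch of Builder's supposed win to follow.
    -- Each reply restores the state and its cover, and `safe` denies the goal on every board met on
    -- the way.
    survive : ∀ {r} → (∀ {B} (S : State B) → Covers S → length B ≤ r → ¬ Goal 3 n B) →
              ∀ t {B} (S : State B) → Covers S → t + length B ≤ r → ¬ BuilderWins 3 n t B
    survive safe zero    S cov len goal = safe S cov len goal
    survive safe (suc t) {B} S cov len (inj₁ goal) = safe S cov (≤-trans (m≤n+m _ (suc t)) len) goal
    survive {r} safe (suc t) {B} S cov len (inj₂ (u , v , u≢v , ¬adj , next)) = reply (degree B u <? τ) (degree B v <? τ)
      where
      len′ : t + suc (length B) ≤ r
      len′ = subst (_≤ r) (sym (+-suc t (length B))) len

      cover : ∀ c {P : Vertex → Set} → (τ ≤ degree ((u , v , c) ∷ B) u → P u) → (τ ≤ degree ((u , v , c) ∷ B) v → P v) →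
              (∀ {x} → Named S x → P x) → ∀ {x} → τ ≤ degree ((u , v , c) ∷ B) x → P x
      cover c atᵘ atᵛ keep {x} active with x ≟ u | x ≟ v
      ... | yes refl | _        = atᵘ active
      ... | no _     | yes refl = atᵛ active
      ... | no x≢u   | no x≢v   = keep (cov (subst (τ ≤_) (degree-∷-other {c = c} B x≢u x≢v) active))

      inactive : degree B u < τ ⊎ degree B v < τ → ⊥
      inactive why = ensureNamed (drawBlue S u≢v ¬adj (inj₁ why)) u λ (S₁ , new₁ , keep₁) →
        ensureNamed S₁ v λ (S₂ , new₂ , keep₂) →
        survive safe t S₂ (cover blue {Named S₂} (keep₂ ∘ new₁) new₂ (keep₂ ∘ keep₁)) len′ (next blue)

      active : Named S u → Named S v → ⊥
      active nu@(i , i<a , refl) nv@(j , j<a , refl) = ¬¬-excluded-middle λ where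
          (yes path) → survive safe t (drawBlue S u≢v ¬adj (inj₂ path)) (covered blue) len′ (next blue)
          (no ¬path) → case flip-small k M n K E g (flips S) (u≢v ∘ cong (name S)) idle (small S) of λ where
            (inj₁ h) → survive safe t (drawFlipped S heads i<a j<a u≢v ¬adj idle (λ _ → ¬path) h)
                         (covered red) len′ (next red)
            (inj₂ h) → survive safe t (drawFlipped S tails i<a j<a u≢v ¬adj idle (λ ()) h)
                         (covered blue) len′ (next blue)
        where
        covered : ∀ c {x} → τ ≤ degree ((u , v , c) ∷ B) x → Named S x
        covered c = cover c {Named S} (λ _ → nu) (λ _ → nv) (λ z → z)
        -- A coin is flipped only when its edge is drawn, and the edge uv has not been drawn.
        idle : flips S i j ≡ unflipped
        idle with flips S i j in eq
        ... | unflipped = refl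
        ... | heads = contradiction (proj₂ (proj₂ (flips-drawn S λ e → contradiction (trans (sym eq) e) λ ()))) ¬adj
        ... | tails = contradiction (proj₂ (proj₂ (flips-drawn S λ e → contradiction (trans (sym eq) e) λ ()))) ¬adj

      reply : Dec (degree B u < τ) → Dec (degree B v < τ) → ⊥
      reply (yes d<τ) _         = inactive (inj₁ d<τ)
      reply (no _)    (yes d<τ) = inactive (inj₂ d<τ)
      reply (no d≮τ)  (no d′≮τ) = active (cov (≮⇒≥ d≮τ)) (cov (≮⇒≥ d′≮τ))

  -- Counting the edges of a blue clique

  choose : ∀ {n} {P : ℕ → ℕ → Set} → (∀ p → p < n → ∃[ x ] P p x) → ∃[ f ] (∀ p → p < n → P p (f p))
  choose {n} {P} H = f , spec
    where
    f : ℕ → ℕ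
    f p with p <? n
    ... | yes p<n = proj₁ (H p p<n)
    ... | no _    = 0
    spec : ∀ p → p < n → P p (f p)
    spec p p<n with p <? n
    ... | yes p<n′ = proj₂ (H p p<n′)
    ... | no p≮n   = contradiction p<n p≮n

  does-true : ∀ {P : Set} (d : Dec P) → does d ≡ true → P
  does-true (yes p) _ = p

  isHeads-heads : ∀ {c} → c ≡ heads → 1 ≤ isHeads c
  isHeads-heads refl = ≤-refl

  isTails-tails : ∀ {c} → c ≡ tails → 1 ≤ isTails c
  isTails-tails refl = ≤-refl

  ∑² : ℕ → (ℕ → ℕ → ℕ) → ℕ
  ∑² n F = ∑ n λ p → ∑ n (F p)

  ∑²-distrib-+ : ∀ n F G → ∑² n (λ p q → F p q + G p q) ≡ ∑² n F + ∑² n G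
  ∑²-distrib-+ n F G = trans (∑-cong n λ p → ∑-distrib-+ n (F p) (G p)) (∑-distrib-+ n (λ p → ∑ n (F p)) _)

  ∑²-mono : ∀ n {F G} → (∀ p q → p < n → q < n → F p q ≤ G p q) → ∑² n F ≤ ∑² n G
  ∑²-mono n h = ∑-mono n λ p p<n → ∑-mono n λ q q<n → h p q p<n q<n

  -- Below 2K the square is at most 4K². Above it, half of `d` is excess, so one factor is bounded
  -- by 2(d - K) and the other by `k`.
  d²-bound : ∀ {d k} K → d ≤ k → d * d ≤ 4 * (K * K) + 2 * k * (d ∸ K)
  d²-bound {d} {k} K d≤k with ≤-total d (2 * K)
  ... | inj₁ d≤2K = ≤-trans (*-mono-≤ d≤2K d≤2K) (≤-trans (≤-reflexive (lemma K)) (m≤m+n _ _))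
    where
    lemma : ∀ K → 2 * K * (2 * K) ≡ 4 * (K * K)
    lemma = solve-∀
  ... | inj₂ 2K≤d = ≤-trans (*-mono-≤ d≤k half) (≤-trans (≤-reflexive (lemma k (d ∸ K))) (m≤n+m _ (4 * (K * K))))
    where
    open ≤-Reasoning
    lemma : ∀ k x → k * (2 * x) ≡ 2 * k * x
    lemma = solve-∀
    half : d ≤ 2 * (d ∸ K)
    half = begin
      d                     ≡⟨ m+n∸n≡m d d ⟨
      d + d ∸ d             ≤⟨ ∸-monoʳ-≤ (d + d) 2K≤d ⟩
      d + d ∸ 2 * K         ≡⟨ cong (_∸ 2 * K) (cong (d +_) (+-identityʳ d)) ⟨
      2 * d ∸ 2 * K         ≡⟨ *-distribˡ-∸ 2 d K ⟨
      2 * (d ∸ K)           ∎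

  module _ (τ k M n K E g : ℕ) .{{_ : NonZero k}} where

    private
      PState : Board → Set
      PState = State τ k M n K E g

    open State

    no-red-triangle : ∀ {B} → PState B → ¬ HasClique B red 3
    no-red-triangle S (f , _ , edges) =
      triangleFree S (edges zero (suc zero) λ ()) (edges (suc zero) (suc (suc zero)) λ ()) (edges zero (suc (suc zero)) λ ())

    -- All n² ordered pairs of positions are counted, diagonal included. Early edges and tails count
    -- twice, since each may be recorded in either orientation; the last two summands pay for the
    -- red paths.
    no-blue-clique : ∀ {B} (S : PState B) → Covers τ k M n K E g S → a S ≤ M → suc τ < n →
      n + 2 * (n * τ) + 2 * (g * k) + (M * (4 * (K * K)) + 2 * k * E) < n * n →
      ∀ h → InjectiveBelow n h → (∀ p q → p < n → q < n → p ≢ q → Edge B blue (h p) (h q)) → ⊥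
    no-blue-clique {B} S cov a≤M τ<n count h h-inj clique = <-irrefl refl (begin-strict
      n * n
        ≡⟨ trans (∑-cong n (λ _ → trans (∑-const n 1) (*-identityʳ n))) (∑-const n n) ⟨
      ∑² n (λ _ _ → 1)
        ≤⟨ ∑²-mono n covered ⟩
      ∑² n (λ p q → same p q + (left p q + left q p) + (tail p q + tail q p) + path p q)
        ≡⟨ trans (∑²-distrib-+ n _ path) (cong (_+ ∑² n path) (trans (∑²-distrib-+ n _ (λ p q → tail p q + tail q p))
             (cong₂ _+_ (∑²-distrib-+ n same _) (∑²-distrib-+ n tail _)))) ⟩
      ∑² n same + ∑² n (λ p q → left p q + left q p) + (∑² n tail + ∑² n (λ p q → tail q p)) + ∑² n path
        ≡⟨ cong₂ (λ x y → ∑² n same + x + y + ∑² n path) (∑²-distrib-+ n left _) (cong (∑² n tail +_) (∑-swap n n (λ p q → tail q p))) ⟩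
      ∑² n same + (∑² n left + ∑² n (λ p q → left q p)) + (∑² n tail + ∑² n tail) + ∑² n path
        ≡⟨ cong (λ x → ∑² n same + (∑² n left + x) + (∑² n tail + ∑² n tail) + ∑² n path) (∑-swap n n (λ p q → left q p)) ⟩
      ∑² n same + (∑² n left + ∑² n left) + (∑² n tail + ∑² n tail) + ∑² n path
        ≤⟨ +-mono-≤ (+-mono-≤ (+-mono-≤ same-≤ (+-mono-≤ left-≤ left-≤)) (+-mono-≤ tail-≤ tail-≤)) path-≤ ⟩
      n + (n * τ + n * τ) + (g * k + g * k) + (M * (4 * (K * K)) + 2 * k * E)
        ≡⟨ regroup n (n * τ) (g * k) (M * (4 * (K * K)) + 2 * k * E) ⟩
      n + 2 * (n * τ) + 2 * (g * k) + (M * (4 * (K * K)) + 2 * k * E)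
        <⟨ count ⟩
      n * n ∎)
      where
      open ≤-Reasoning
      regroup : ∀ a b c d → a + (b + b) + (c + c) + d ≡ a + 2 * b + 2 * c + d
      regroup = solve-∀

      left : ℕ → ℕ → ℕ
      left p q = early τ B (h p) (h q)

      left-row : ∀ p → ∑ n (left p) ≤ τ
      left-row p = proj₁ (∑-early τ B (h p) (loopless S) h-inj)

      -- Were the vertex inactive, all its n - 1 clique edges would be early, but at most τ edges at
      -- a vertex are.
      is-active : ∀ p → p < n → τ ≤ degree B (h p)
      is-active p p<n with degree B (h p) <? τ
      ... | no d≮τ = ≮⇒≥ d≮τ
      ... | yes d<τ = contradiction (begin
        n                                              ≡⟨ trans (∑-const n 1) (*-identityʳ n) ⟨
        ∑ n (λ _ → 1)                                  ≤⟨ ∑-mono n each ⟩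
        ∑ n (λ q → ⟦ q ≟ p ⟧ + left p q)               ≡⟨ ∑-distrib-+ n (λ q → ⟦ q ≟ p ⟧) (left p) ⟩
        ∑ n (λ q → ⟦ q ≟ p ⟧) + ∑ n (left p)           ≤⟨ +-mono-≤ (∑-fibre≤1 n (λ _ _ e → e) p) (left-row p) ⟩
        suc τ                                          ∎) (<⇒≱ τ<n)
        where
        each : ∀ q → q < n → 1 ≤ ⟦ q ≟ p ⟧ + left p q
        each q q<n with q ≟ p
        ... | yes e = ≤-trans (≤-reflexive (sym (⟦⟧-yes (q ≟ p) e))) (m≤m+n _ _)
        ... | no q≢p = ≤-trans (edge⇒early τ B (clique p q p<n q<n (q≢p ∘ sym)) (<⇒≤ d<τ)) (m≤n+m _ ⟦ q ≟ p ⟧)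

      indices : ∃[ ι ] (∀ p → p < n → ι p < a S × name S (ι p) ≡ h p)
      indices = choose λ p p<n → cov (is-active p p<n)

      ι : ℕ → ℕ
      ι = proj₁ indices

      ι<a : ∀ {p} → p < n → ι p < a S
      ι<a p<n = proj₁ (proj₂ indices _ p<n)

      name-ι : ∀ {p} → p < n → name S (ι p) ≡ h p
      name-ι p<n = proj₂ (proj₂ indices _ p<n)

      ι<M : ∀ p → p < n → ι p < M
      ι<M p p<n = <-≤-trans (ι<a p<n) a≤M

      ι-inj : InjectiveBelow n ι
      ι-inj p<n q<n e = h-inj p<n q<n (trans (sym (name-ι p<n)) (trans (cong (name S) e) (name-ι q<n)))

      L : List ℕ
      L = applyDownFrom ι n

      χ : ℕ → Bool
      χ = member L

      weight : ℕ → ℕ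
      weight i = if χ i then 1 else 0

      χ-ι : ∀ {p} → p < n → χ (ι p) ≡ true
      χ-ι p<n = dec-true (_ ∈? L) (∈-applyDownFrom⁺ ι p<n)

      weight-ι : ∀ p → p < n → 1 ≤ weight (ι p)
      weight-ι p p<n rewrite χ-ι p<n = ≤-refl

      χ-index : ∀ {i} → χ i ≡ true → ∃[ p ] p < n × i ≡ ι p
      χ-index {i} e = ∈-applyDownFrom⁻ ι (does-true (i ∈? L) e)

      L<M : All (_< M) L
      L<M = All.applyDownFrom⁺₁ ι n (ι<M _)

      monochromatic : ∀ {p q} → p < n → q < n → ¬ Edge B red (h p) (h q)
      monochromatic {p} {q} p<n q<n r with p ≟ q
      ... | yes refl = loopless S r refl
      ... | no p≢q   = unicoloured S r (clique p q p<n q<n p≢q)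

      independent : ∀ i j → χ i ≡ true → χ j ≡ true → flips S i j ≢ heads
      independent i j χi χj e with χ-index χi | χ-index χj
      ... | p , p<n , refl | q , q<n , refl =
        monochromatic p<n q<n (subst₂ (Edge B red) (name-ι p<n) (name-ι q<n) (heads-red S e))

      same tail path : ℕ → ℕ → ℕ
      same p q = ⟦ q ≟ p ⟧
      tail p q = isTails (flips S (ι p) (ι q))
      -- Members of χ may be given 0: a midpoint inside the clique would be joined in red to another
      -- of its vertices. Only coins between the clique and its outside remain, as in
      -- `excessPotential`.
      path p q = ∑ M λ w → if χ w then 0 else headsBetween (flips S) w (ι p) * headsBetween (flips S) w (ι q)

      same-≤ : ∑² n same ≤ n
      same-≤ = ≤-trans (∑-≤-const n 1 λ p _ → ∑-fibre≤1 n (λ _ _ e → e) p) (≤-reflexive (*-identityʳ n))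

      left-≤ : ∑² n left ≤ n * τ
      left-≤ = ∑-≤-const n τ λ p _ → left-row p

      tail-≤ : ∑² n tail ≤ g * k
      tail-≤ = begin
        ∑ n (λ p → ∑ n (λ q → t (ι p) (ι q)))
          ≤⟨ ∑-mono n (λ p _ → ∑-reindex n M {w = weight} (t (ι p)) ι-inj ι<M weight-ι) ⟩
        ∑ n (λ p → ∑ M (λ j → weight j * t (ι p) j))
          ≤⟨ ∑-reindex n M {w = weight} (λ i → ∑ M (λ j → weight j * t i j)) ι-inj ι<M weight-ι ⟩
        ∑ M (λ i → weight i * ∑ M (λ j → weight j * t i j))
          ≡⟨ ∑-cong M (λ i → ∑-distribˡ-* M (weight i) _) ⟨
        ∑ M (λ i → ∑ M (λ j → weight i * (weight j * t i j)))
          ≡⟨ ∑-cong M (λ i → ∑-cong M (entry i)) ⟩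
        tailsWithin M χ (flips S)
          ≤⟨ <⇒≤ (tails<g*k k M n K E g (small S) (length-applyDownFrom ι n) L<M independent) ⟩
        g * k ∎
        where
        t : ℕ → ℕ → ℕ
        t i j = isTails (flips S i j)
        entry : ∀ i j → weight i * (weight j * t i j) ≡ (if χ i ∧ χ j then t i j else 0)
        entry i j with χ i | χ j
        ... | false | _     = refl
        ... | true  | false = refl
        ... | true  | true  = trans (*-identityˡ _) (*-identityˡ _)

      -- Summing over midpoints first turns the count of pairs with a common red neighbour into a
      -- sum of squared red degrees into the clique.
      path-≤ : ∑² n path ≤ M * (4 * (K * K)) + 2 * k * E
      path-≤ = begin
        ∑ n (λ p → ∑ n (λ q → ∑ M (λ w → c w p q)))     ≡⟨ ∑-cong n (λ p → ∑-swap n M (λ q w → c w p q)) ⟩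
        ∑ n (λ p → ∑ M (λ w → ∑ n (λ q → c w p q)))     ≡⟨ ∑-swap n M (λ p w → ∑ n (λ q → c w p q)) ⟩
        ∑ M (λ w → ∑² n (c w))                          ≤⟨ ∑-mono M witness ⟩
        ∑ M (λ w → 4 * (K * K) + 2 * k * e w)           ≡⟨ ∑-distrib-+ M (λ _ → 4 * (K * K)) _ ⟩
        ∑ M (λ _ → 4 * (K * K)) + ∑ M (λ w → 2 * k * e w) ≡⟨ cong₂ _+_ (∑-const M _) (∑-distribˡ-* M (2 * k) e) ⟩
        M * (4 * (K * K)) + 2 * k * ∑ M e
          ≤⟨ +-monoʳ-≤ (M * (4 * (K * K))) (*-monoʳ-≤ (2 * k) (<⇒≤ (excess<E k M n K E g (small S) (length-applyDownFrom ι n) L<M))) ⟩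
        M * (4 * (K * K)) + 2 * k * E ∎
        where
        b : ℕ → ℕ → ℕ
        b = headsBetween (flips S)
        c : ℕ → ℕ → ℕ → ℕ
        c w p q = if χ w then 0 else b w (ι p) * b w (ι q)
        e : ℕ → ℕ
        e = excess M K χ (flips S)
        d : ℕ → ℕ
        d = headsInto M χ (flips S)
        d≤k : ∀ {w} → w < M → d w ≤ k
        d≤k {w} w<M = ≤-trans (∑-mono M entry) (<⇒≤ (degree<k k M n K E g (small S) w<M))
          where
          entry : ∀ s → s < M → (if χ s then b w s else 0) ≤ b w s
          entry s _ with χ s
          ... | true  = ≤-refl
          ... | false = z≤n
        into : ∀ w → ∑ n (λ p → b w (ι p)) ≤ d w
        into w = ≤-trans (∑-reindex n M {w = weight} (b w) ι-inj ι<M weight-ι) (≤-reflexive (∑-cong M entry))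
          where
          entry : ∀ s → weight s * b w s ≡ (if χ s then b w s else 0)
          entry s with χ s
          ... | true  = *-identityˡ _
          ... | false = refl
        witness : ∀ w → w < M → ∑² n (c w) ≤ 4 * (K * K) + 2 * k * e w
        witness w w<M with χ w
        ... | true = ≤-trans (∑-≤-const n 0 λ _ _ → ≤-trans (∑-≤-const n 0 λ _ _ → ≤-refl) (≤-reflexive (*-zeroʳ n)))
                       (≤-trans (≤-reflexive (*-zeroʳ n)) z≤n)
        ... | false = begin
          ∑ n (λ p → ∑ n (λ q → b w (ι p) * b w (ι q)))        ≡⟨ ∑-cong n (λ p → ∑-distribˡ-* n (b w (ι p)) _) ⟩
          ∑ n (λ p → b w (ι p) * ∑ n (λ q → b w (ι q)))        ≡⟨ ∑-distribʳ-* n (∑ n (λ q → b w (ι q))) _ ⟩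
          ∑ n (λ p → b w (ι p)) * ∑ n (λ q → b w (ι q))        ≤⟨ *-mono-≤ (into w) (into w) ⟩
          d w * d w                                            ≤⟨ d²-bound K (d≤k w<M) ⟩
          4 * (K * K) + 2 * k * (d w ∸ K)                      ∎

      named-ι : ∀ {i p} → i < a S → p < n → name S i ≡ h p → i ≡ ι p
      named-ι i<a p<n e = name-inj S i<a (ι<a p<n) (trans e (sym (name-ι p<n)))

      heads-at : ∀ {w p} → p < n → Edge B red w (h p) →
                 ∃[ i ] i < a S × name S i ≡ w × 1 ≤ headsBetween (flips S) i (ι p)
      heads-at p<n r with red-heads S r
      ... | i , j , (i<a , j<a) , (ei , ej) , s with named-ι j<a p<n ej
      ...   | refl = i , i<a , ei ,
        [ (λ e → ≤-trans (isHeads-heads e) (m≤m+n _ _)) , (λ e → ≤-trans (isHeads-heads e) (m≤n+m _ _)) ]′ s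

      lefts : ∀ {p q} → left p q + left q p ≤ same p q + (left p q + left q p) + (tail p q + tail q p) + path p q
      lefts {p} {q} = ≤-trans (m≤n+m _ (same p q)) (≤-trans (m≤m+n _ (tail p q + tail q p)) (m≤m+n _ (path p q)))

      covered : ∀ p q → p < n → q < n → 1 ≤ same p q + (left p q + left q p) + (tail p q + tail q p) + path p q
      covered p q p<n q<n with q ≟ p
      ... | yes e rewrite ⟦⟧-yes (q ≟ p) e = s≤s z≤n
      ... | no q≢p with blue-cause S (clique p q p<n q<n (q≢p ∘ sym))
      ...   | inj₁ (inj₁ l) = ≤-trans (≤-trans l (m≤m+n _ (left q p))) lefts
      ...   | inj₁ (inj₂ l) = ≤-trans (≤-trans l (m≤n+m _ (left p q))) lefts
      ...   | inj₂ (inj₁ (i , j , (i<a , j<a) , (ei , ej) , s)) with named-ι i<a p<n ei | named-ι j<a q<n ej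
      ...     | refl | refl = ≤-trans
        ([ (λ e → ≤-trans (isTails-tails e) (m≤m+n _ (tail q p))) , (λ e → ≤-trans (isTails-tails e) (m≤n+m _ (tail p q))) ]′ s)
        (≤-trans (m≤n+m _ (same p q + (left p q + left q p))) (m≤m+n _ (path p q)))
      covered p q p<n q<n | no q≢p | inj₂ (inj₂ (w , r , r′)) with heads-at p<n r | heads-at q<n r′
      ... | i , i<a , refl , hp | i′ , i′<a , e , hq with name-inj S i′<a i<a e
      ...   | refl = ≤-trans (≤-trans outside (term≤∑ via (<-≤-trans i<a a≤M)))
                       (m≤n+m _ (same p q + (left p q + left q p) + (tail p q + tail q p)))
        where
        via : ℕ → ℕ
        via w = if χ w then 0 else headsBetween (flips S) w (ι p) * headsBetween (flips S) w (ι q)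
        outside : 1 ≤ via i
        outside with χ i in χi
        ... | false = *-mono-≤ hp hq
        ... | true with χ-index χi
        ...   | p′ , p′<n , refl = contradiction (subst (λ x → Edge B red x (h p)) (name-ι p′<n) r) (monochromatic p′<n p<n)

    safe : ∀ {r} → suc τ < n → 2 * r < suc M * τ →
      n + 2 * (n * τ) + 2 * (g * k) + (M * (4 * (K * K)) + 2 * k * E) < n * n →
      ∀ {B} (S : PState B) → Covers τ k M n K E g S → length B ≤ r → ¬ Goal 3 n B
    safe τ<n few count S cov len (inj₁ clique) = no-red-triangle S clique
    safe {r} τ<n few count {B} S cov len (inj₂ (f , f-inj , edges)) with choose vertices
      where
      vertices : ∀ p → p < n → ∃[ x ] ∃[ p<n ] x ≡ f (fromℕ< {p} p<n)
      vertices p p<n = f (fromℕ< p<n) , p<n , refl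
    ... | h , spec = no-blue-clique S cov a≤M τ<n count h h-inj clique
      where
      open ≤-Reasoning
      -- Handshaking: `a` vertices of degree at least τ need aτ ≤ 2r.
      a≤M : a S ≤ M
      a≤M = ≤-pred (*-cancelʳ-< τ (a S) (suc M) (begin-strict
        a S * τ                                    ≡⟨ ∑-const (a S) τ ⟨
        ∑ (a S) (λ _ → τ)                          ≤⟨ ∑-mono (a S) (λ i i<a → name-active S i<a) ⟩
        ∑ (a S) (λ i → degree B (name S i))        ≤⟨ ∑-degree≤ B (name-inj S) ⟩
        2 * length B                               ≤⟨ *-monoʳ-≤ 2 len ⟩
        2 * r                                      <⟨ few ⟩
        suc M * τ                                  ∎))
      h-inj : InjectiveBelow n h
      h-inj {p} {q} p<n q<n e with spec p p<n | spec q q<n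
      ... | p<n′ , ep | q<n′ , eq = fromℕ<-injective p q p<n′ q<n′ (f-inj (trans (sym ep) (trans e eq)))
      clique : ∀ p q → p < n → q < n → p ≢ q → Edge B blue (h p) (h q)
      clique p q p<n q<n p≢q with spec p p<n | spec q q<n
      ... | p<n′ , ep | q<n′ , eq = subst₂ (Edge B blue) (sym ep) (sym eq)
        (edges _ _ λ e → p≢q (fromℕ<-injective p q p<n′ q<n′ e))

    builder-loses : ∀ {r} → 1 ≤ τ → suc τ < n → 2 * r < suc M * τ →
      4 * (M * (suc k * suc k) ^ M) ≤ 2 ^ k * (k * k) ^ M →
      2 * (M * (suc k * suc k) ^ n) ≤ 2 ^ K * (k * k) ^ n →
      8 * M ^ n ≤ 2 ^ E → 4 * M ^ n ≤ 2 ^ g →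
      n + 2 * (n * τ) + 2 * (g * k) + (M * (4 * (K * K)) + 2 * k * E) < n * n →
      ¬ BuilderWins 3 n r []
    builder-loses {r} τ≥1 τ<n few h₁ h₂ h₃ h₄ count =
      survive τ k M n K E g (safe τ<n few count) r start (λ τ≤0 → contradiction (≤-trans τ≥1 τ≤0) λ ()) (≤-reflexive (+-identityʳ r))
      where
      start : PState []
      start = record
        { a = 0 ; name = λ _ → 0 ; flips = initial
        ; name-inj = λ () ; name-active = λ () ; flips-drawn = λ f → contradiction refl f ; heads-red = λ ()
        ; loopless = λ { (inj₁ ()) ; (inj₂ ()) } ; unicoloured = λ { (inj₁ ()) ; (inj₂ ()) }
        ; triangleFree = λ { (inj₁ ()) ; (inj₂ ()) }
        ; small = Φ-initial k M n K E g h₁ h₂ h₃ h₄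
        ; red-heads = λ { (inj₁ ()) ; (inj₂ ()) } ; blue-cause = λ { (inj₁ ()) ; (inj₂ ()) } }

  -- Choice of the parameters

  m<[1+m/n]*n : ∀ m n .{{_ : NonZero n}} → m < suc (m / n) * n
  m<[1+m/n]*n m n = subst (_< n + m / n * n) (sym (m≡m%n+[m/n]*n m n)) (+-monoˡ-< (m / n * n) (m%n<n m n))

  ^-distribʳ-* : ∀ m a b → (a * b) ^ m ≡ a ^ m * b ^ m
  ^-distribʳ-* m a b = trans (sym (∏-const m (a * b))) (trans (∏-distrib-* m _ _) (cong₂ _*_ (∏-const m a) (∏-const m b)))

  -- A block of m ≤ k/2 factors 1 + 1/k is worth at most 2, and x factors fit into `c` blocks.
  [1+k]^x≤2^c*k^x : ∀ k m .{{_ : NonZero k}} → 2 * m ≤ k → ∀ c {x} → x ≤ c * m → suc k ^ x ≤ 2 ^ c * k ^ x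
  [1+k]^x≤2^c*k^x k m 2m≤k zero    z≤n = ≤-refl
  [1+k]^x≤2^c*k^x k m 2m≤k (suc c) {x} x≤ with ≤-total x m
  ... | inj₁ x≤m = begin
    suc k ^ x              ≡⟨ cong (_^ x) (+-comm k 1) ⟨
    (k + 1) ^ x
      ≤⟨ [a+y]^m≤2a^m k 1 x (≤-trans (*-monoʳ-≤ 2 (≤-trans (≤-reflexive (*-identityʳ x)) x≤m)) 2m≤k) ⟩
    2 * k ^ x              ≤⟨ *-monoˡ-≤ (k ^ x) (*-monoʳ-≤ 2 (m^n>0 2 c)) ⟩
    2 ^ suc c * k ^ x      ∎
    where open ≤-Reasoning
  ... | inj₂ m≤x with m≤n⇒∃[o]m+o≡n m≤x
  ...   | (y , refl) rewrite ^-distribˡ-+-* (suc k) m y | ^-distribˡ-+-* k m y = begin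
    suc k ^ m * suc k ^ y            ≤⟨ *-mono-≤ once ([1+k]^x≤2^c*k^x k m 2m≤k c (+-cancelˡ-≤ m y (c * m) x≤)) ⟩
    2 * k ^ m * (2 ^ c * k ^ y)      ≡⟨ lemma 2 (k ^ m) (2 ^ c) (k ^ y) ⟩
    2 * 2 ^ c * (k ^ m * k ^ y)      ∎
    where
    open ≤-Reasoning
    lemma : ∀ a b c d → a * b * (c * d) ≡ a * c * (b * d)
    lemma = solve-∀
    once : suc k ^ m ≤ 2 * k ^ m
    once = subst (λ z → z ^ m ≤ 2 * k ^ m) (+-comm k 1)
      ([a+y]^m≤2a^m k 1 m (≤-trans (*-monoʳ-≤ 2 (≤-reflexive (*-identityʳ m))) 2m≤k))

  [1+k]²^x≤2^2c*k²^x : ∀ k m .{{_ : NonZero k}} → 2 * m ≤ k → ∀ c {x} → x ≤ c * m →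
                       (suc k * suc k) ^ x ≤ 2 ^ (c + c) * (k * k) ^ x
  [1+k]²^x≤2^2c*k²^x k m 2m≤k c {x} x≤ = begin
    (suc k * suc k) ^ x                  ≡⟨ ^-distribʳ-* x (suc k) (suc k) ⟩
    suc k ^ x * suc k ^ x                ≤⟨ *-mono-≤ once once ⟩
    2 ^ c * k ^ x * (2 ^ c * k ^ x)      ≡⟨ [m*n]*[o*p]≡[m*o]*[n*p] (2 ^ c) (k ^ x) (2 ^ c) (k ^ x) ⟩
    2 ^ c * 2 ^ c * (k ^ x * k ^ x)      ≡⟨ cong₂ _*_ (^-distribˡ-+-* 2 c c) (^-distribʳ-* x k k) ⟨
    2 ^ (c + c) * (k * k) ^ x            ∎
    where
    open ≤-Reasoning
    once = [1+k]^x≤2^c*k^x k m 2m≤k c x≤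

  -- In units of n²/16 the five terms cost at most 1, 4, 1, 4 and 1, which is 11 out of 16.
  scaled-count : ∀ n a b c d → 16 ≤ n → 8 * a ≤ n * n → 32 * b ≤ n * n → 16 * c ≤ 4 * (n * n) → 16 * d ≤ n * n →
                 n + 2 * a + 2 * b + (c + d) < n * n
  scaled-count n a b c d 16≤n ha hb hc hd = *-cancelˡ-< 16 _ _ (begin-strict
    16 * (n + 2 * a + 2 * b + (c + d))                    ≡⟨ expand n a b c d ⟩
    16 * n + 4 * (8 * a) + 32 * b + (16 * c + 16 * d)
      ≤⟨ +-mono-≤ (+-mono-≤ (+-mono-≤ (*-monoˡ-≤ n 16≤n) (*-monoʳ-≤ 4 ha)) hb) (+-mono-≤ hc hd) ⟩
    N + 4 * N + N + (4 * N + N)                           ≡⟨ collect N ⟩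
    11 * N
      <⟨ *-monoˡ-< N {{m*n≢0 n n {{n≢0}} {{n≢0}}}} (from-yes (11 <? 16)) ⟩
    16 * N                                                ∎)
    where
    open ≤-Reasoning
    N = n * n
    n≢0 : NonZero n
    n≢0 = >-nonZero (≤-trans (s≤s z≤n) 16≤n)
    expand : ∀ n a b c d → 16 * (n + 2 * a + 2 * b + (c + d)) ≡ 16 * n + 4 * (8 * a) + 32 * b + (16 * c + 16 * d)
    expand = solve-∀
    collect : ∀ N → N + 4 * N + N + (4 * N + N) ≡ 11 * N
    collect = solve-∀

  -- Makes n/(640ℓ) exceed 2ℓ, so that a power 2^(2c) can absorb a factor polynomial in n. The shift
  -- by 20 is the origin of the threshold on n.
  640ℓ[1+2ℓ]≤2^ℓ : ∀ j → 640 * (j + 20) * suc (2 * (j + 20)) ≤ 2 ^ (j + 20)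
  640ℓ[1+2ℓ]≤2^ℓ zero = from-yes (524800 ≤? 1048576)
  640ℓ[1+2ℓ]≤2^ℓ (suc j) = begin
    640 * suc (j + 20) * suc (2 * suc (j + 20))        ≤⟨ m≤m+n _ (640 * (2 * (j * j) + 77 * j + 737)) ⟩
    640 * suc (j + 20) * suc (2 * suc (j + 20)) + 640 * (2 * (j * j) + 77 * j + 737)  ≡⟨ lemma j ⟩
    2 * (640 * (j + 20) * suc (2 * (j + 20)))          ≤⟨ *-monoʳ-≤ 2 (640ℓ[1+2ℓ]≤2^ℓ j) ⟩
    2 * 2 ^ (j + 20)                                   ∎
    where
    open ≤-Reasoning
    lemma : ∀ j → 640 * (1 + (j + 20)) * (1 + 2 * (1 + (j + 20))) + 640 * (2 * (j * j) + 77 * j + 737)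
                ≡ 2 * (640 * (j + 20) * (1 + 2 * (j + 20)))
    lemma = solve-∀

  -- 2^(5ℓ) absorbs the factor 2M and 2^(640ℓ + 640ℓ) absorbs (1 + 1/k)^(2n).
  scale : ℕ → ℕ
  scale ℓ = 5 * ℓ + (640 * ℓ + 640 * ℓ)

  module _ {n ℓ r : ℕ} (20≤ℓ : 20 ≤ ℓ) (2^ℓ≤n : 2 ^ ℓ ≤ n) (n<2^[1+ℓ] : n < 2 ^ suc ℓ)
           (few : 512 * (scale ℓ * scale ℓ) * r < n * n * n) where

    private
      ℓ≢0 : NonZero ℓ
      ℓ≢0 = >-nonZero (≤-trans (s≤s z≤n) 20≤ℓ)

      640ℓ≢0 : NonZero (640 * ℓ)
      640ℓ≢0 = m*n≢0 640 ℓ {{_}} {{ℓ≢0}}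

      c k τ M K : ℕ
      -- 640 = 32 · 5 · 4: with k = 4c and both `g` and `E` equal to 5ℓn, the tails and the excess
      -- then cost at most n²/16 each. The multiple of 4 makes k/2 = 2c the block length for powers
      -- of 1 + 1/k.
      c = _/_ n (640 * ℓ) {{640ℓ≢0}}
      k = 4 * c
      τ = n / 8
      K = scale ℓ

      1+2ℓ≤c : suc (2 * ℓ) ≤ c
      1+2ℓ≤c = ≤-pred (*-cancelʳ-< (640 * ℓ) _ _ (≤-<-trans
        (≤-trans (≤-reflexive (*-comm (suc (2 * ℓ)) (640 * ℓ))) (≤-trans growth 2^ℓ≤n))
        (m<[1+m/n]*n n (640 * ℓ) {{640ℓ≢0}})))
        where
        growth : 640 * ℓ * suc (2 * ℓ) ≤ 2 ^ ℓ
        growth = subst (λ ℓ → 640 * ℓ * suc (2 * ℓ) ≤ 2 ^ ℓ) (m∸n+n≡m 20≤ℓ) (640ℓ[1+2ℓ]≤2^ℓ (ℓ ∸ 20))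

      c≢0 : NonZero c
      c≢0 = >-nonZero (≤-trans (s≤s z≤n) 1+2ℓ≤c)
      k≢0 : NonZero k
      k≢0 = m*n≢0 4 c {{_}} {{c≢0}}

      640ℓc≤n : 640 * ℓ * c ≤ n
      640ℓc≤n = ≤-trans (≤-reflexive (*-comm (640 * ℓ) c)) (m/n*n≤m n (640 * ℓ) {{640ℓ≢0}})

      16≤n : 16 ≤ n
      16≤n = ≤-trans (from-yes (16 ≤? 20)) (≤-trans 20≤ℓ (≤-trans (m≤n*m ℓ 640) (≤-trans (m≤m*n (640 * ℓ) c {{c≢0}}) 640ℓc≤n)))

      τ≥1 : 1 ≤ τ
      τ≥1 = /-monoˡ-≤ 8 (≤-trans (from-yes (8 ≤? 16)) 16≤n)

      τ≢0 : NonZero τ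
      τ≢0 = >-nonZero τ≥1
      n≢0 : NonZero n
      n≢0 = >-nonZero (≤-trans (s≤s z≤n) 16≤n)

      M = _/_ (2 * r) τ {{τ≢0}}

      8τ≤n : 8 * τ ≤ n
      8τ≤n = ≤-trans (≤-reflexive (*-comm 8 τ)) (m/n*n≤m n 8)

      n≤16τ : n ≤ 16 * τ
      n≤16τ = begin
        n                 ≤⟨ <⇒≤ (m<[1+m/n]*n n 8) ⟩
        8 + τ * 8         ≤⟨ +-monoˡ-≤ (τ * 8) (≤-trans (≤-reflexive (*-identityˡ 8)) (*-monoˡ-≤ 8 τ≥1)) ⟩
        τ * 8 + τ * 8     ≡⟨ lemma τ ⟩
        16 * τ            ∎
        where
        open ≤-Reasoning
        lemma : ∀ τ → τ * 8 + τ * 8 ≡ 16 * τ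
        lemma = solve-∀

      n≤640ℓ2c : n ≤ 640 * ℓ * (2 * c)
      n≤640ℓ2c = begin
        n                             ≤⟨ <⇒≤ (m<[1+m/n]*n n (640 * ℓ) {{640ℓ≢0}}) ⟩
        suc c * (640 * ℓ)             ≤⟨ *-monoˡ-≤ (640 * ℓ) (+-monoˡ-≤ c (≤-trans (s≤s z≤n) 1+2ℓ≤c)) ⟩
        (c + c) * (640 * ℓ)           ≡⟨ lemma c (640 * ℓ) ⟩
        640 * ℓ * (2 * c)             ∎
        where
        open ≤-Reasoning
        lemma : ∀ c w → (c + c) * w ≡ w * (2 * c)
        lemma = solve-∀

      Mn≤32r : M * n ≤ 32 * r
      Mn≤32r = begin
        M * n             ≤⟨ *-monoʳ-≤ M n≤16τ ⟩
        M * (16 * τ)      ≡⟨ l₁ M τ ⟩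
        16 * (M * τ)      ≤⟨ *-monoʳ-≤ 16 (m/n*n≤m (2 * r) τ {{τ≢0}}) ⟩
        16 * (2 * r)      ≡⟨ l₂ r ⟩
        32 * r            ∎
        where
        open ≤-Reasoning
        l₁ : ∀ M τ → M * (16 * τ) ≡ 16 * (M * τ)
        l₁ = solve-∀
        l₂ : ∀ r → 16 * (2 * r) ≡ 32 * r
        l₂ = solve-∀

      -- The assumption that `r` is small enters here: 512 = 16 · 32, where 32 comes from Mn ≤ 32r
      -- and 16 makes the term 4K²M at most n²/4.
      16K²M≤n² : 16 * (K * K) * M ≤ n * n
      16K²M≤n² = *-cancelʳ-≤ _ _ n {{n≢0}} (<⇒≤ (begin-strict
        16 * (K * K) * M * n         ≡⟨ *-assoc (16 * (K * K)) M n ⟩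
        16 * (K * K) * (M * n)       ≤⟨ *-monoʳ-≤ (16 * (K * K)) Mn≤32r ⟩
        16 * (K * K) * (32 * r)      ≡⟨ lemma (K * K) r ⟩
        512 * (K * K) * r            <⟨ few ⟩
        n * n * n                    ∎))
        where
        open ≤-Reasoning
        lemma : ∀ x r → 16 * x * (32 * r) ≡ 512 * x * r
        lemma = solve-∀

      K≢0 : NonZero K
      K≢0 = >-nonZero (≤-trans (≤-trans (s≤s z≤n) 20≤ℓ) (≤-trans (m≤n*m ℓ 5) (m≤m+n (5 * ℓ) _)))

      n≤Kc : n ≤ K * c
      n≤Kc = begin
        n                             ≤⟨ n≤640ℓ2c ⟩
        640 * ℓ * (2 * c)             ≡⟨ lemma (640 * ℓ) c ⟩
        (640 * ℓ + 640 * ℓ) * c       ≤⟨ *-monoˡ-≤ c (m≤n+m _ (5 * ℓ)) ⟩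
        K * c                         ∎
        where
        open ≤-Reasoning
        lemma : ∀ w c → w * (2 * c) ≡ (w + w) * c
        lemma = solve-∀

      -- This puts the expected red degree, about M/k, far below `k`, so that a red degree of `k` is
      -- exponentially unlikely.
      16M≤c² : 16 * M ≤ c * c
      16M≤c² = *-cancelˡ-≤ (K * K) {{m*n≢0 K K {{K≢0}} {{K≢0}}}} (begin
        K * K * (16 * M)          ≡⟨ l₁ (K * K) M ⟩
        16 * (K * K) * M          ≤⟨ 16K²M≤n² ⟩
        n * n                     ≤⟨ *-mono-≤ n≤Kc n≤Kc ⟩
        K * c * (K * c)           ≡⟨ l₂ K c ⟩
        K * K * (c * c)           ∎)
        where
        open ≤-Reasoning
        l₁ : ∀ x M → x * (16 * M) ≡ 16 * x * M
        l₁ = solve-∀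
        l₂ : ∀ K c → K * c * (K * c) ≡ K * K * (c * c)
        l₂ = solve-∀

      M≤c[2c] : M ≤ c * (2 * c)
      M≤c[2c] = ≤-trans (m≤n*m M 16) (≤-trans 16M≤c² (*-monoʳ-≤ c (m≤n*m c 2)))

      M≤2^4ℓ : M ≤ 2 ^ (4 * ℓ)
      M≤2^4ℓ = begin
        M
          ≤⟨ m≤n*m M (16 * (K * K)) {{m*n≢0 16 (K * K) {{_}} {{m*n≢0 K K {{K≢0}} {{K≢0}}}}}} ⟩
        16 * (K * K) * M                  ≤⟨ 16K²M≤n² ⟩
        n * n                             ≤⟨ *-mono-≤ (<⇒≤ n<2^[1+ℓ]) (<⇒≤ n<2^[1+ℓ]) ⟩
        2 ^ suc ℓ * 2 ^ suc ℓ             ≡⟨ ^-distribˡ-+-* 2 (suc ℓ) (suc ℓ) ⟨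
        2 ^ (suc ℓ + suc ℓ)               ≤⟨ ^-monoʳ-≤ 2 (+-mono-≤ 1+ℓ≤ 1+ℓ≤) ⟩
        2 ^ (ℓ + ℓ + (ℓ + ℓ))             ≡⟨ cong (2 ^_) (lemma ℓ) ⟩
        2 ^ (4 * ℓ)                       ∎
        where
        open ≤-Reasoning
        lemma : ∀ ℓ → ℓ + ℓ + (ℓ + ℓ) ≡ 4 * ℓ
        lemma = solve-∀
        1+ℓ≤ : suc ℓ ≤ ℓ + ℓ
        1+ℓ≤ = +-monoˡ-≤ ℓ (≤-trans (s≤s z≤n) 20≤ℓ)

      2^*M≤ : ∀ a {e} → a + 4 * ℓ ≤ e → 2 ^ a * M ≤ 2 ^ e
      2^*M≤ a {e} h = begin
        2 ^ a * M                 ≤⟨ *-monoʳ-≤ (2 ^ a) M≤2^4ℓ ⟩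
        2 ^ a * 2 ^ (4 * ℓ)       ≡⟨ ^-distribˡ-+-* 2 a (4 * ℓ) ⟨
        2 ^ (a + 4 * ℓ)           ≤⟨ ^-monoʳ-≤ 2 h ⟩
        2 ^ e                     ∎
        where open ≤-Reasoning

      -- M^n uses 4ℓn of the exponent 5ℓn; the remaining ℓn absorbs the constant factor 4 or 8.
      2^*M^n≤ : ∀ a → a ≤ 3 → 2 ^ a * M ^ n ≤ 2 ^ (5 * ℓ * n)
      2^*M^n≤ a a≤3 = begin
        2 ^ a * M ^ n                  ≤⟨ *-monoʳ-≤ (2 ^ a) (^-monoˡ-≤ n M≤2^4ℓ) ⟩
        2 ^ a * (2 ^ (4 * ℓ)) ^ n      ≡⟨ cong (2 ^ a *_) (^-*-assoc 2 (4 * ℓ) n) ⟩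
        2 ^ a * 2 ^ (4 * ℓ * n)        ≡⟨ ^-distribˡ-+-* 2 a (4 * ℓ * n) ⟨
        2 ^ (a + 4 * ℓ * n)
          ≤⟨ ^-monoʳ-≤ 2 (+-monoˡ-≤ (4 * ℓ * n) (≤-trans a≤3 (≤-trans (≤-trans (from-yes (3 ≤? 20)) 20≤ℓ) (m≤m*n ℓ n {{n≢0}})))) ⟩
        2 ^ (ℓ * n + 4 * ℓ * n)        ≡⟨ cong (2 ^_) (lemma ℓ n) ⟩
        2 ^ (5 * ℓ * n)                ∎
        where
        open ≤-Reasoning
        lemma : ∀ ℓ n → ℓ * n + 4 * ℓ * n ≡ 5 * ℓ * n
        lemma = solve-∀

      2[2c]≤k : 2 * (2 * c) ≤ k
      2[2c]≤k = ≤-reflexive (sym (*-assoc 2 2 c))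

      -- The budget 2^k splits into two halves 2^(2c): one pays for the factor 4M of the union
      -- bound, the other for (1 + 1/k)^(2M).
      degree-start : 4 * (M * (suc k * suc k) ^ M) ≤ 2 ^ k * (k * k) ^ M
      degree-start = begin
        4 * (M * (suc k * suc k) ^ M)               ≡⟨ *-assoc 4 M _ ⟨
        4 * M * (suc k * suc k) ^ M
          ≤⟨ *-mono-≤ (2^*M≤ 2 {c + c} room) ([1+k]²^x≤2^2c*k²^x k (2 * c) {{k≢0}} 2[2c]≤k c M≤c[2c]) ⟩
        2 ^ (c + c) * (2 ^ (c + c) * (k * k) ^ M)   ≡⟨ *-assoc (2 ^ (c + c)) (2 ^ (c + c)) _ ⟨
        2 ^ (c + c) * 2 ^ (c + c) * (k * k) ^ M     ≡⟨ cong (_* (k * k) ^ M) (^-distribˡ-+-* 2 (c + c) (c + c)) ⟨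
        2 ^ (c + c + (c + c)) * (k * k) ^ M         ≡⟨ cong (λ e → 2 ^ e * (k * k) ^ M) (lemma c) ⟩
        2 ^ k * (k * k) ^ M                         ∎
        where
        open ≤-Reasoning
        lemma : ∀ c → c + c + (c + c) ≡ 4 * c
        lemma = solve-∀
        lemma′ : ∀ ℓ → 2 + 4 * ℓ ≡ 1 + 2 * ℓ + (1 + 2 * ℓ)
        lemma′ = solve-∀
        room : 2 + 4 * ℓ ≤ c + c
        room = ≤-trans (≤-reflexive (lemma′ ℓ)) (+-mono-≤ 1+2ℓ≤c 1+2ℓ≤c)

      excess-start : 2 * (M * (suc k * suc k) ^ n) ≤ 2 ^ K * (k * k) ^ n
      excess-start = begin
        2 * (M * (suc k * suc k) ^ n)                  ≡⟨ *-assoc 2 M _ ⟨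
        2 * M * (suc k * suc k) ^ n
          ≤⟨ *-mono-≤ (2^*M≤ 1 {5 * ℓ} (+-monoˡ-≤ (4 * ℓ) (≤-trans (s≤s z≤n) 20≤ℓ))) ([1+k]²^x≤2^2c*k²^x k (2 * c) {{k≢0}} 2[2c]≤k (640 * ℓ) n≤640ℓ2c) ⟩
        2 ^ (5 * ℓ) * (2 ^ w * (k * k) ^ n)            ≡⟨ *-assoc (2 ^ (5 * ℓ)) (2 ^ w) _ ⟨
        2 ^ (5 * ℓ) * 2 ^ w * (k * k) ^ n              ≡⟨ cong (_* (k * k) ^ n) (^-distribˡ-+-* 2 (5 * ℓ) w) ⟨
        2 ^ K * (k * k) ^ n                            ∎
        where
        open ≤-Reasoning
        w = 640 * ℓ + 640 * ℓ

      32[5ℓn]k≤n² : 32 * (5 * ℓ * n * k) ≤ n * n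
      32[5ℓn]k≤n² = ≤-trans (≤-reflexive (lemma ℓ n c)) (*-monoˡ-≤ n 640ℓc≤n)
        where
        lemma : ∀ ℓ n c → 32 * (5 * ℓ * n * (4 * c)) ≡ 640 * ℓ * c * n
        lemma = solve-∀

      count : n + 2 * (n * τ) + 2 * (5 * ℓ * n * k) + (M * (4 * (K * K)) + 2 * k * (5 * ℓ * n)) < n * n
      count = scaled-count n (n * τ) (5 * ℓ * n * k) (M * (4 * (K * K))) (2 * k * (5 * ℓ * n)) 16≤n
        (≤-trans (≤-reflexive (l₁ n τ)) (*-monoʳ-≤ n 8τ≤n))
        32[5ℓn]k≤n²
        (≤-trans (≤-reflexive (l₂ (K * K) M)) (*-monoʳ-≤ 4 16K²M≤n²))
        (≤-trans (≤-reflexive (l₃ k (5 * ℓ * n))) 32[5ℓn]k≤n²)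
        where
        l₁ : ∀ n τ → 8 * (n * τ) ≡ n * (8 * τ)
        l₁ = solve-∀
        l₂ : ∀ x M → 16 * (M * (4 * x)) ≡ 4 * (16 * x * M)
        l₂ = solve-∀
        l₃ : ∀ k x → 16 * (2 * k * x) ≡ 32 * (x * k)
        l₃ = solve-∀

      1+τ<n : suc τ < n
      1+τ<n = *-cancelˡ-≤ 8 (begin
        8 * suc (suc τ)     ≡⟨ lemma τ ⟩
        16 + 8 * τ          ≤⟨ +-mono-≤ 16≤n 8τ≤n ⟩
        n + n               ≤⟨ m≤m+n (n + n) (6 * n) ⟩
        n + n + 6 * n       ≡⟨ lemma′ n ⟩
        8 * n               ∎)
        where
        open ≤-Reasoning
        lemma : ∀ τ → 8 * (1 + (1 + τ)) ≡ 16 + 8 * τ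
        lemma = solve-∀
        lemma′ : ∀ n → n + n + 6 * n ≡ 8 * n
        lemma′ = solve-∀

    builder-loses-early : ¬ BuilderWins 3 n r []
    builder-loses-early = builder-loses τ k M n K (5 * ℓ * n) (5 * ℓ * n) {{k≢0}} τ≥1 1+τ<n (m<[1+m/n]*n (2 * r) τ {{τ≢0}})
      degree-start excess-start (2^*M^n≤ 3 ≤-refl) (2^*M^n≤ 2 (s≤s (s≤s z≤n))) count

open Game using (^-cancelʳ-<; builder-loses-early)

open import Defs
open import Data.Nat.Base using (ℕ; _≥_)
open import Data.Product.Base using (∃-syntax; _×_)
open import Data.Rational.Base using (ℚ; 0ℚ; _<_; _≤_; _*_)

import Data.Integer.Base as ℤ
import Data.Integer.Properties as ℤ
open import Data.List.Base using ([])
open import Data.Nat.Base as ℕ using (zero; suc; z≤n; s≤s; _!)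
import Data.Nat.Properties as ℕ
open import Data.Nat.Tactic.RingSolver using (solve-∀)
open import Data.Product.Base using (_,_; proj₁)
open import Data.Rational.Base using (1ℚ; _+_; _/_; toℚᵘ; Positive; NonNegative; nonNegative)
open import Data.Rational.Properties
open import Data.Rational.Solver using (module +-*-Solver)
import Data.Rational.Unnormalised.Base as ℚᵘ
import Data.Rational.Unnormalised.Properties as ℚᵘ
open import Relation.Binary.PropositionalEquality
open import Relation.Nullary using (yes; no; contradiction)
open +-*-Solver using (solve; _:=_; _:+_; _:*_; con)

-- Rational arithmetic and the logarithm

toℚᵘ-/ : ∀ p q .{{_ : ℕ.NonZero q}} → toℚᵘ (p / q) ℚᵘ.≃ (p ℚᵘ./ q)
toℚᵘ-/ p (suc q-1) = toℚᵘ-fromℚᵘ (ℚᵘ.mkℚᵘ p q-1)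

fromℕ-* : ∀ m n → fromℕ (m ℕ.* n) ≡ fromℕ m * fromℕ n
fromℕ-* m n = toℚᵘ-injective (begin
  toℚᵘ (fromℕ (m ℕ.* n))                      ≈⟨ toℚᵘ-/ (ℤ.+ (m ℕ.* n)) 1 ⟩
  ℚᵘ.mkℚᵘ (ℤ.+ (m ℕ.* n)) 0                   ≡⟨ cong (λ z → ℚᵘ.mkℚᵘ z 0) (ℤ.pos-* m n) ⟩
  ℚᵘ.mkℚᵘ (ℤ.+ m) 0 ℚᵘ.* ℚᵘ.mkℚᵘ (ℤ.+ n) 0    ≈⟨ ℚᵘ.*-cong (toℚᵘ-/ (ℤ.+ m) 1) (toℚᵘ-/ (ℤ.+ n) 1) ⟨
  toℚᵘ (fromℕ m) ℚᵘ.* toℚᵘ (fromℕ n)          ≈⟨ toℚᵘ-homo-* (fromℕ m) (fromℕ n) ⟨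
  toℚᵘ (fromℕ m * fromℕ n)                    ∎)
  where open import Relation.Binary.Reasoning.Setoid ℚᵘ.≃-setoid

fromℕ-mono : ∀ {m n} → m ℕ.≤ n → fromℕ m ≤ fromℕ n
fromℕ-mono {m} {n} m≤n = toℚᵘ-cancel-≤ (ℚᵘ.≤-respʳ-≃ (ℚᵘ.≃-sym (toℚᵘ-/ (ℤ.+ n) 1)) (ℚᵘ.≤-respˡ-≃ (ℚᵘ.≃-sym (toℚᵘ-/ (ℤ.+ m) 1))
  (ℚᵘ.*≤* (ℤ.*-monoʳ-≤-nonNeg (ℤ.+ 1) (ℤ.+≤+ m≤n)))))

fromℕ-positive : ∀ n .{{_ : ℕ.NonZero n}} → Positive (fromℕ n)
fromℕ-positive n = normalize-pos n 1

fromℕ-nonNegative : ∀ n → NonNegative (fromℕ n)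
fromℕ-nonNegative n = normalize-nonNeg n 1

fromℕ*1/ : ∀ d .{{_ : ℕ.NonZero d}} → fromℕ d * (ℤ.+ 1 / d) ≡ 1ℚ
fromℕ*1/ d@(suc d-1) = toℚᵘ-injective (begin
  toℚᵘ (fromℕ d * (ℤ.+ 1 / d))                     ≈⟨ toℚᵘ-homo-* (fromℕ d) (ℤ.+ 1 / d) ⟩
  toℚᵘ (fromℕ d) ℚᵘ.* toℚᵘ (ℤ.+ 1 / d)             ≈⟨ ℚᵘ.*-cong (toℚᵘ-/ (ℤ.+ d) 1) (toℚᵘ-/ (ℤ.+ 1) d) ⟩
  ℚᵘ.mkℚᵘ (ℤ.+ d) 0 ℚᵘ.* ℚᵘ.mkℚᵘ (ℤ.+ 1) d-1       ≈⟨ ℚᵘ.*≡* (cong (λ z → ℤ.+ suc z) (lemma d-1)) ⟩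
  toℚᵘ 1ℚ                                          ∎)
  where
  open import Relation.Binary.Reasoning.Setoid ℚᵘ.≃-setoid
  lemma : ∀ d → d ℕ.* 1 ℕ.* 1 ≡ d ℕ.+ 0 ℕ.+ 0
  lemma = solve-∀

-- The mean value estimate for x^(i+1) on [a, a + 1]; it lets the next bound be proved by induction
-- on the base.
[1+a]^[1+i]≤ : ∀ a i → suc a ℕ.^ suc i ℕ.≤ a ℕ.^ suc i ℕ.+ suc i ℕ.* suc a ℕ.^ i
[1+a]^[1+i]≤ a zero    = ℕ.≤-reflexive (lemma a)
  where
  lemma : ∀ a → (1 ℕ.+ a) ℕ.* 1 ≡ a ℕ.* 1 ℕ.+ 1
  lemma = solve-∀
[1+a]^[1+i]≤ a (suc i) = begin
  suc a ℕ.* p                                            ≡⟨⟩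
  p ℕ.+ a ℕ.* p                                          ≤⟨ ℕ.+-monoʳ-≤ p (ℕ.*-monoʳ-≤ a ([1+a]^[1+i]≤ a i)) ⟩
  p ℕ.+ a ℕ.* (a ℕ.^ suc i ℕ.+ suc i ℕ.* suc a ℕ.^ i)    ≤⟨ ℕ.m≤m+n _ (suc i ℕ.* suc a ℕ.^ i) ⟩
  p ℕ.+ a ℕ.* (a ℕ.^ suc i ℕ.+ suc i ℕ.* suc a ℕ.^ i) ℕ.+ suc i ℕ.* suc a ℕ.^ i
                                                         ≡⟨ lemma a i (a ℕ.^ suc i) (suc a ℕ.^ i) ⟩
  a ℕ.^ suc (suc i) ℕ.+ suc (suc i) ℕ.* p                ∎
  where
  open ℕ.≤-Reasoning
  p = suc a ℕ.^ suc i
  lemma : ∀ a i x y → (1 ℕ.+ a) ℕ.* y ℕ.+ a ℕ.* (x ℕ.+ (1 ℕ.+ i) ℕ.* y) ℕ.+ (1 ℕ.+ i) ℕ.* y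
                    ≡ a ℕ.* x ℕ.+ (2 ℕ.+ i) ℕ.* ((1 ℕ.+ a) ℕ.* y)
  lemma = solve-∀

-- Says ℓ^i / i! ≤ 2^(ℓ+i-1) for ℓ = l + 1. In the induction both summands have a power of 2 one
-- lower than the target, so together they reach it.
2ℓ^i≤2^[ℓ+i]i! : ∀ l i → 2 ℕ.* suc l ℕ.^ i ℕ.≤ 2 ℕ.^ (suc l ℕ.+ i) ℕ.* i !
2ℓ^i≤2^[ℓ+i]i! zero    i = ℕ.*-mono-≤ {2} {2 ℕ.^ suc i} (ℕ.*-monoʳ-≤ 2 (ℕ.m^n>0 2 i)) (ℕ.≤-trans (ℕ.≤-reflexive (ℕ.^-zeroˡ i)) (1≤i! i))
  where
  1≤i! : ∀ i → 1 ℕ.≤ i !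
  1≤i! i = ℕ.>-nonZero⁻¹ (i !) {{i ℕ.!≢0}}
2ℓ^i≤2^[ℓ+i]i! (suc l) zero    = ℕ.*-monoˡ-≤ 1 (ℕ.*-monoʳ-≤ 2 (ℕ.m^n>0 2 (suc l ℕ.+ 0)))
2ℓ^i≤2^[ℓ+i]i! (suc l) (suc i) = begin
  2 ℕ.* suc (suc l) ℕ.^ suc i
    ≤⟨ ℕ.*-monoʳ-≤ 2 ([1+a]^[1+i]≤ (suc l) i) ⟩
  2 ℕ.* (suc l ℕ.^ suc i ℕ.+ suc i ℕ.* suc (suc l) ℕ.^ i)
    ≡⟨ l₁ (suc l ℕ.^ suc i) (suc i) (suc (suc l) ℕ.^ i) ⟩
  2 ℕ.* suc l ℕ.^ suc i ℕ.+ suc i ℕ.* (2 ℕ.* suc (suc l) ℕ.^ i)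
    ≤⟨ ℕ.+-mono-≤ (2ℓ^i≤2^[ℓ+i]i! l (suc i)) (ℕ.*-monoʳ-≤ (suc i) (2ℓ^i≤2^[ℓ+i]i! (suc l) i)) ⟩
  2 ℕ.^ (suc l ℕ.+ suc i) ℕ.* (suc i) ! ℕ.+ suc i ℕ.* (2 ℕ.^ (suc (suc l) ℕ.+ i) ℕ.* i !)
    ≡⟨ cong (λ e → 2 ℕ.^ e ℕ.* (suc i) ! ℕ.+ suc i ℕ.* (2 ℕ.^ (suc (suc l) ℕ.+ i) ℕ.* i !)) (ℕ.+-suc (suc l) i) ⟩
  2 ℕ.^ (suc (suc l) ℕ.+ i) ℕ.* (suc i ℕ.* i !) ℕ.+ suc i ℕ.* (2 ℕ.^ (suc (suc l) ℕ.+ i) ℕ.* i !)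
    ≡⟨ l₂ (2 ℕ.^ (suc (suc l) ℕ.+ i)) (suc i) (i !) ⟩
  2 ℕ.* 2 ℕ.^ (suc (suc l) ℕ.+ i) ℕ.* (suc i) !
    ≡⟨ cong (λ e → 2 ℕ.^ e ℕ.* (suc i) !) (ℕ.+-suc (suc (suc l)) i) ⟨
  2 ℕ.^ (suc (suc l) ℕ.+ suc i) ℕ.* (suc i) !
    ∎
  where
  open ℕ.≤-Reasoning
  l₁ : ∀ a s b → 2 ℕ.* (a ℕ.+ s ℕ.* b) ≡ 2 ℕ.* a ℕ.+ s ℕ.* (2 ℕ.* b)
  l₁ = solve-∀
  l₂ : ∀ p s f → p ℕ.* (s ℕ.* f) ℕ.+ s ℕ.* (p ℕ.* f) ≡ 2 ℕ.* p ℕ.* (s ℕ.* f)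
  l₂ = solve-∀

^-nonNegative : ∀ p .{{_ : NonNegative p}} i → NonNegative (p ^ i)
^-nonNegative p zero    = _
^-nonNegative p (suc i) = nonNeg*nonNeg⇒nonNeg p (p ^ i) {{^-nonNegative p i}}

*-mono-≤-nonNeg : ∀ {p q r s} .{{_ : NonNegative q}} .{{_ : NonNegative r}} → p ≤ q → r ≤ s → p * r ≤ q * s
*-mono-≤-nonNeg {p} {q} {r} {s} p≤q r≤s = ≤-trans (*-monoʳ-≤-nonNeg r p≤q) (*-monoˡ-≤-nonNeg q r≤s)

-- 4^i is split as 2^i · 2^i: one factor cancels the 2^i in the bound on ℓ^i / i!, the other leaves
-- a geometric decay.
[4u]^i≤ℓ^i : ∀ {u ℓ} .{{_ : NonNegative u}} → fromℕ 4 * u ≤ fromℕ ℓ → ∀ i →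
             fromℕ (2 ℕ.^ i) * fromℕ (2 ℕ.^ i) * u ^ i ≤ fromℕ (ℓ ℕ.^ i)
[4u]^i≤ℓ^i h zero = ≤-refl
[4u]^i≤ℓ^i {u} {ℓ} h (suc i) = begin
  fromℕ (2 ℕ.^ suc i) * fromℕ (2 ℕ.^ suc i) * (u * u ^ i)
    ≡⟨ cong₂ (λ x y → x * y * (u * u ^ i)) (fromℕ-* 2 (2 ℕ.^ i)) (fromℕ-* 2 (2 ℕ.^ i)) ⟩
  fromℕ 2 * A * (fromℕ 2 * A) * (u * u ^ i)
    ≡⟨ solve 4 (λ t a u v → t :* a :* (t :* a) :* (u :* v) := t :* t :* u :* (a :* a :* v)) refl (fromℕ 2) A u (u ^ i) ⟩
  fromℕ 4 * u * (A * A * u ^ i)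
    ≤⟨ *-mono-≤-nonNeg {{fromℕ-nonNegative ℓ}} {{AAu}} h ([4u]^i≤ℓ^i h i) ⟩
  fromℕ ℓ * fromℕ (ℓ ℕ.^ i)
    ≡⟨ fromℕ-* ℓ (ℓ ℕ.^ i) ⟨
  fromℕ (ℓ ℕ.^ suc i) ∎
  where
  open ≤-Reasoning
  A = fromℕ (2 ℕ.^ i)
  AAu : NonNegative (A * A * u ^ i)
  AAu = nonNeg*nonNeg⇒nonNeg (A * A) {{nonNeg*nonNeg⇒nonNeg A {{fromℕ-nonNegative (2 ℕ.^ i)}} A {{fromℕ-nonNegative (2 ℕ.^ i)}}}}
          (u ^ i) {{^-nonNegative u i}}

module _ {u : ℚ} {l : ℕ} .{{_ : NonNegative u}} (4u≤ℓ : fromℕ 4 * u ≤ fromℕ (suc l)) where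

  private
    X : ℚ
    X = fromℕ (2 ℕ.^ suc l)

    pow2 : ℕ → ℚ
    pow2 i = fromℕ (2 ℕ.^ i)

    pow2-positive : ∀ i → Positive (pow2 i)
    pow2-positive i = fromℕ-positive (2 ℕ.^ i) {{ℕ.m^n≢0 2 i}}

    1/! : ℕ → ℚ
    1/! i = _/_ (ℤ.+ 1) (i !) {{i ℕ.!≢0}}

  term-bound : ∀ i → fromℕ 2 * pow2 i * (u ^ i * 1/! i) ≤ X
  term-bound i = *-cancelʳ-≤-pos P {{pow2-positive i}} (begin
    fromℕ 2 * P * (u ^ i * I) * P
      ≡⟨ solve 4 (λ t p v i → t :* p :* (v :* i) :* p := t :* (p :* p :* v) :* i) refl (fromℕ 2) P (u ^ i) I ⟩
    fromℕ 2 * (P * P * u ^ i) * I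
      ≤⟨ *-monoʳ-≤-nonNeg I {{normalize-nonNeg 1 (i !) {{i ℕ.!≢0}}}} (*-monoˡ-≤-nonNeg (fromℕ 2) ([4u]^i≤ℓ^i {ℓ = suc l} 4u≤ℓ i)) ⟩
    fromℕ 2 * fromℕ (suc l ℕ.^ i) * I
      ≡⟨ cong (_* I) (fromℕ-* 2 (suc l ℕ.^ i)) ⟨
    fromℕ (2 ℕ.* suc l ℕ.^ i) * I
      ≤⟨ *-monoʳ-≤-nonNeg I {{normalize-nonNeg 1 (i !) {{i ℕ.!≢0}}}} (fromℕ-mono (2ℓ^i≤2^[ℓ+i]i! l i)) ⟩
    fromℕ (2 ℕ.^ (suc l ℕ.+ i) ℕ.* i !) * I
      ≡⟨ cong (_* I) (trans (cong (λ z → fromℕ (z ℕ.* i !)) (ℕ.^-distribˡ-+-* 2 (suc l) i))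
                       (trans (fromℕ-* (2 ℕ.^ suc l ℕ.* 2 ℕ.^ i) (i !)) (cong (_* fromℕ (i !)) (fromℕ-* (2 ℕ.^ suc l) (2 ℕ.^ i))))) ⟩
    X * P * fromℕ (i !) * I
      ≡⟨ *-assoc (X * P) (fromℕ (i !)) I ⟩
    X * P * (fromℕ (i !) * I)
      ≡⟨ cong (X * P *_) (fromℕ*1/ (i !) {{i ℕ.!≢0}}) ⟩
    X * P * 1ℚ
      ≡⟨ *-identityʳ (X * P) ⟩
    X * P ∎)
    where
    open ≤-Reasoning
    P = pow2 i
    I = 1/! i

  -- Since u^i / i! ≤ 2^(ℓ-1-i), the partial sum is at most 2^ℓ (1 - 2^-(j+1)). The summand `X`
  -- keeps the part reserved for the later terms, without which the induction would not close.
  scaled-expSum : ∀ j → pow2 (suc j) * expSum u j + X ≤ pow2 (suc j) * X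
  scaled-expSum zero = begin
    fromℕ 2 * 1ℚ + X       ≤⟨ +-monoˡ-≤ X (fromℕ-mono {2} {2 ℕ.^ suc l} (ℕ.*-monoʳ-≤ 2 (ℕ.m^n>0 2 l))) ⟩
    X + X                  ≡⟨ solve 1 (λ x → x :+ x := (con 1ℚ :+ con 1ℚ) :* x) refl X ⟩
    fromℕ 2 * X            ∎
    where open ≤-Reasoning
  scaled-expSum (suc j) = begin
    pow2 (suc (suc j)) * (e + t) + X        ≡⟨ cong (λ z → z * (e + t) + X) (fromℕ-* 2 (2 ℕ.^ suc j)) ⟩
    fromℕ 2 * A * (e + t) + X
      ≡⟨ solve 5 (λ b a e t x → b :* a :* (e :+ t) :+ x := b :* (a :* e) :+ (b :* a :* t :+ x)) refl (fromℕ 2) A e t X ⟩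
    fromℕ 2 * (A * e) + (fromℕ 2 * A * t + X) ≤⟨ +-monoʳ-≤ (fromℕ 2 * (A * e)) (+-monoˡ-≤ X (term-bound (suc j))) ⟩
    fromℕ 2 * (A * e) + (X + X)
      ≡⟨ solve 2 (λ y x → (con 1ℚ :+ con 1ℚ) :* y :+ (x :+ x) := (con 1ℚ :+ con 1ℚ) :* (y :+ x)) refl (A * e) X ⟩
    fromℕ 2 * (A * e + X)                   ≤⟨ *-monoˡ-≤-nonNeg (fromℕ 2) (scaled-expSum j) ⟩
    fromℕ 2 * (A * X)                       ≡⟨ *-assoc (fromℕ 2) A X ⟨
    fromℕ 2 * A * X                         ≡⟨ cong (_* X) (fromℕ-* 2 (2 ℕ.^ suc j)) ⟨
    pow2 (suc (suc j)) * X                  ∎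
    where
    open ≤-Reasoning
    A = pow2 (suc j)
    e = expSum u j
    t = u ^ suc j * 1/! (suc j)

  expSum-bound : ∀ j → expSum u j ≤ X
  expSum-bound j = *-cancelˡ-≤-pos (pow2 (suc j)) {{pow2-positive (suc j)}} (≤-trans
    (≤-trans (≤-reflexive (sym (+-identityʳ _))) (+-monoʳ-≤ (pow2 (suc j) * expSum u j) (nonNegative⁻¹ X {{fromℕ-nonNegative (2 ℕ.^ suc l)}})))
    (scaled-expSum j))

-- If 4u were below ℓ, every partial sum of exp u would be at most 2^ℓ ≤ n, contrary to log n < u.
-- This is a weak form of log n ≥ ℓ log 2, and it costs only a constant.
log-bound : ∀ {n ℓ u} → 1 ℕ.≤ ℓ → 2 ℕ.^ ℓ ℕ.≤ n → log n <ℚ u → fromℕ ℓ ≤ fromℕ 4 * u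
log-bound {n} {suc l} {u} _ 2^ℓ≤n (0<u , j , n<exp) with fromℕ (suc l) ≤? fromℕ 4 * u
... | yes h = h
... | no ≰ = contradiction (<-≤-trans n<exp (≤-trans (expSum-bound {u} {l} {{nonNegative (<⇒≤ 0<u)}} (<⇒≤ (≰⇒> ≰)) j) (fromℕ-mono 2^ℓ≤n))) (<-irrefl refl)

⌊log₂⌋ : ∀ n → 1 ℕ.≤ n → ∃[ ℓ ] 2 ℕ.^ ℓ ℕ.≤ n × n ℕ.< 2 ℕ.^ suc ℓ
⌊log₂⌋ (suc zero)    _ = 0 , s≤s z≤n , s≤s (s≤s z≤n)
⌊log₂⌋ (suc (suc n)) _ with ⌊log₂⌋ (suc n) (s≤s z≤n)
... | ℓ , low , high with suc (suc n) ℕ.<? 2 ℕ.^ suc ℓ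
...   | yes lt = ℓ , ℕ.m≤n⇒m≤1+n low , lt
...   | no ≮ = suc ℓ , ℕ.≮⇒≥ ≮ , ℕ.≤-<-trans high (ℕ.^-monoʳ-< 2 (s≤s (s≤s z≤n)) (ℕ.n<1+n (suc ℓ)))

-- From the natural-number bound to the theorem

-- `a` and `b` stand for 512 and 1285; as variables they keep the rational calculation free of large
-- numerals.
turns-bound : ∀ {a b n r : ℕ} {u ℓ} .{{_ : NonNegative u}} → fromℕ ℓ ≤ fromℕ 4 * u →
              n ℕ.* n ℕ.* n ℕ.≤ a ℕ.* (b ℕ.* ℓ ℕ.* (b ℕ.* ℓ)) ℕ.* r →
              fromℕ n ^ 3 ≤ fromℕ (a ℕ.* (b ℕ.* 4 ℕ.* (b ℕ.* 4))) * (fromℕ r * u ^ 2)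
turns-bound {a} {b} {n} {r} {u} {ℓ} ℓ≤4u h = begin
  fromℕ n ^ 3
    ≡⟨ solve 1 (λ n → n :* (n :* (n :* con 1ℚ)) := n :* n :* n) refl (fromℕ n) ⟩
  fromℕ n * fromℕ n * fromℕ n
    ≡⟨ trans (fromℕ-* (n ℕ.* n) n) (cong (_* fromℕ n) (fromℕ-* n n)) ⟨
  fromℕ (n ℕ.* n ℕ.* n)
    ≤⟨ fromℕ-mono {n ℕ.* n ℕ.* n} {a ℕ.* (b ℕ.* ℓ ℕ.* (b ℕ.* ℓ)) ℕ.* r} h ⟩
  fromℕ (a ℕ.* (b ℕ.* ℓ ℕ.* (b ℕ.* ℓ)) ℕ.* r)
    ≡⟨ trans (fromℕ-* (a ℕ.* (b ℕ.* ℓ ℕ.* (b ℕ.* ℓ))) r) (cong (_* fromℕ r) (trans (fromℕ-* a (b ℕ.* ℓ ℕ.* (b ℕ.* ℓ))) (cong (fromℕ a *_)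
         (trans (fromℕ-* (b ℕ.* ℓ) (b ℕ.* ℓ)) (cong₂ _*_ (fromℕ-* b ℓ) (fromℕ-* b ℓ)))))) ⟩
  fromℕ a * (fromℕ b * fromℕ ℓ * (fromℕ b * fromℕ ℓ)) * fromℕ r
    ≤⟨ *-monoʳ-≤-nonNeg (fromℕ r) {{fromℕ-nonNegative r}} (*-monoˡ-≤-nonNeg (fromℕ a) {{fromℕ-nonNegative a}}
         (*-mono-≤-nonNeg {{b*4u}} {{b*ℓ}} b*ℓ≤b*4u b*ℓ≤b*4u)) ⟩
  fromℕ a * (fromℕ b * (fromℕ 4 * u) * (fromℕ b * (fromℕ 4 * u))) * fromℕ r
    ≡⟨ solve 5 (λ a b c r u → a :* (b :* (c :* u) :* (b :* (c :* u))) :* r := a :* (b :* c :* (b :* c)) :* (r :* (u :* (u :* con 1ℚ))))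
         refl (fromℕ a) (fromℕ b) (fromℕ 4) (fromℕ r) u ⟩
  fromℕ a * (fromℕ b * fromℕ 4 * (fromℕ b * fromℕ 4)) * (fromℕ r * u ^ 2)
    ≡⟨ cong (_* (fromℕ r * u ^ 2)) (trans (fromℕ-* a (b ℕ.* 4 ℕ.* (b ℕ.* 4))) (cong (fromℕ a *_)
         (trans (fromℕ-* (b ℕ.* 4) (b ℕ.* 4)) (cong₂ _*_ (fromℕ-* b 4) (fromℕ-* b 4))))) ⟨
  fromℕ (a ℕ.* (b ℕ.* 4 ℕ.* (b ℕ.* 4))) * (fromℕ r * u ^ 2) ∎
  where
  open ≤-Reasoning
  b*ℓ≤b*4u : fromℕ b * fromℕ ℓ ≤ fromℕ b * (fromℕ 4 * u)
  b*ℓ≤b*4u = *-monoˡ-≤-nonNeg (fromℕ b) {{fromℕ-nonNegative b}} ℓ≤4u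
  b*ℓ : NonNegative (fromℕ b * fromℕ ℓ)
  b*ℓ = nonNeg*nonNeg⇒nonNeg (fromℕ b) {{fromℕ-nonNegative b}} (fromℕ ℓ) {{fromℕ-nonNegative ℓ}}
  b*4u : NonNegative (fromℕ b * (fromℕ 4 * u))
  b*4u = nonNegative (≤-trans (nonNegative⁻¹ _ {{b*ℓ}}) b*ℓ≤b*4u)

divide : ∀ D .{{_ : ℕ.NonZero D}} {x y} → x ≤ fromℕ D * y → (ℤ.+ 1 / D) * x ≤ y
divide D {x} {y} h = begin
  I * x                  ≤⟨ *-monoˡ-≤-nonNeg I {{normalize-nonNeg 1 D}} h ⟩
  I * (fromℕ D * y)      ≡⟨ solve 3 (λ i d y → i :* (d :* y) := d :* i :* y) refl I (fromℕ D) y ⟩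
  fromℕ D * I * y        ≡⟨ cong (_* y) (fromℕ*1/ D) ⟩
  1ℚ * y                 ≡⟨ *-identityˡ y ⟩
  y                      ∎
  where
  open ≤-Reasoning
  I = ℤ.+ 1 / D

scale-≡ : ∀ ℓ → 5 ℕ.* ℓ ℕ.+ (640 ℕ.* ℓ ℕ.+ 640 ℕ.* ℓ) ≡ 1285 ℕ.* ℓ
scale-≡ = solve-∀

builder-turns : ∀ {n ℓ r} → 20 ℕ.≤ ℓ → 2 ℕ.^ ℓ ℕ.≤ n → n ℕ.< 2 ℕ.^ suc ℓ → BuilderWins 3 n r [] →
                n ℕ.* n ℕ.* n ℕ.≤ 512 ℕ.* (1285 ℕ.* ℓ ℕ.* (1285 ℕ.* ℓ)) ℕ.* r
builder-turns {n} {ℓ} {r} 20≤ℓ low high wins = ℕ.≮⇒≥ λ few →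
  builder-loses-early 20≤ℓ low high (subst (λ K → 512 ℕ.* (K ℕ.* K) ℕ.* r ℕ.< n ℕ.* n ℕ.* n) (sym (scale-≡ ℓ)) few) wins

online-ramsey-bound : ∀ {e n r u} → 20 ℕ.≤ e → 2 ℕ.^ e ℕ.≤ n → BuilderWins 3 n r [] → log n <ℚ u →
                      fromℕ n ^ 3 ≤ fromℕ (512 ℕ.* (1285 ℕ.* 4 ℕ.* (1285 ℕ.* 4))) * (fromℕ r * u ^ 2)
online-ramsey-bound {e} {n} {r} {u} 20≤e 2^e≤n wins log<u =
  let ℓ , low , high = ⌊log₂⌋ n (ℕ.≤-trans (ℕ.m^n>0 2 e) 2^e≤n)
      20≤ℓ = ℕ.≤-trans 20≤e (ℕ.≤-pred (^-cancelʳ-< 2 {e} {suc ℓ} (ℕ.≤-<-trans 2^e≤n high)))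
  in turns-bound {512} {1285} {n} {r} {u} {ℓ} {{nonNegative (<⇒≤ (proj₁ log<u))}}
       (log-bound {n} {ℓ} {u} (ℕ.≤-trans (s≤s z≤n) 20≤ℓ) low log<u)
       (builder-turns {n} {ℓ} {r} 20≤ℓ low high wins)

theorem4 :
    ∃[ c ] 0ℚ < c × (∃[ N ]
      (∀ (n : ℕ) → n ≥ N →
       ∀ (r : ℕ) → IsOnlineRamseyNumber 3 n r →
       ∀ (u : ℚ) → log n <ℚ u →
       c * fromℕ n ^ 3 ≤ fromℕ r * u ^ 2))
-- `D` is 512K² with K = 1285ℓ after ℓ is replaced by its bound 4u and u² is split off; n ≥ 2^20
-- guarantees ℓ ≥ 20.
theorem4 = ℤ.+ 1 / D , positive⁻¹ (ℤ.+ 1 / D) {{normalize-pos 1 D}} , 2 ℕ.^ 20 ,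
  λ n N≤n r (wins , _) u log<u → divide D (online-ramsey-bound {20} {n} {r} {u} ℕ.≤-refl N≤n wins log<u)
  where
  D : ℕ
  D = 512 ℕ.* (1285 ℕ.* 4 ℕ.* (1285 ℕ.* 4))
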